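{- Let $B_n=\sum_{k=1}^n \frac{2}{n(n+1)^2}\binom{n+1}{k-1}\binom{n+1}{k}\binom{n+1}{k+1}$ for $n\ge 1$ (the Baxter numbers). Then the sequence $\{B_n\}_{n\ge 1}$ is asymptotically $r$-log-convex for every integer $r\ge 1$. Moreover, $\{B_n\}_{n\ge 1}$ is $2$-log-convex.
   Context: For a real sequence $\{a_n\}$, define the operator $\mathscr{L}(\{a_n\})=\{a_na_{n+2}-a_{n+1}^2\}$ (indexed from the same starting index), and let $\mathscr{L}^j$ denote its $j$-th iterate. The sequence is $r$-log-convex if $\mathscr{L}^j(\{a_n\})$ is a nonnegative sequence for every $1\le j\le r$. It is asymptotically $r$-log-convex if, for each $1\le j\le r$, all terms of $\mathscr{L}^j(\{a_n\})$ are nonnegative except possibly finitely many initial terms. -}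

module Defs where

open import Data.Nat as ℕ using (ℕ; zero; suc)
open import Data.Nat.Combinatorics using (_C_)
open import Data.Integer using (+_)
open import Data.Rational using (ℚ; _+_; _*_; _-_; _≤_; 0ℚ; _/_)
open import Data.List using (List; map; upTo; foldr)

-- Real sequences are modelled by rational sequences (all sequences here are rational),
-- indexed from 0; a sequence {a_n}_{n≥1} is represented by i ↦ a_{i+1}.
Seq : Set
Seq = ℕ → ℚ

𝓛 : Seq → Seq
𝓛 a n = a n * a (suc (suc n)) - a (suc n) * a (suc n)

𝓛^ : ℕ → Seq → Seq
𝓛^ zero a = a
𝓛^ (suc j) a = 𝓛 (𝓛^ j a)

LogConvex : ℕ → Seq → Set
LogConvex r a = ∀ j → 1 ℕ.≤ j → j ℕ.≤ r → ∀ n → 0ℚ ≤ 𝓛^ j a n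

AsympLogConvex : ℕ → Seq → Set
AsympLogConvex r a =
  ∀ j → 1 ℕ.≤ j → j ℕ.≤ r → Σ ℕ λ N → ∀ n → N ℕ.≤ n → 0ℚ ≤ 𝓛^ j a n
  where open import Data.Product using (Σ)

toℚ : ℕ → ℚ
toℚ m = (+ m) / 1

sumℚ : List ℚ → ℚ
sumℚ = foldr _+_ 0ℚ

-- Baxter number B_n = Σ_{k=1}^n 2/(n(n+1)^2) C(n+1,k-1) C(n+1,k) C(n+1,k+1), for n ≥ 1.
-- B n is defined for n = suc m (so that n ≥ 1 and the denominator is nonzero);
-- k - 1 is natural subtraction, exact since k ≥ 1.
B : (n : ℕ) → ⦃ ℕ.NonZero n ⦄ → ℚ
B n = sumℚ (map term (map suc (upTo n)))
  where
  term : ℕ → ℚ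
  term k = ((+ 2) / n) * ((+ 1) / suc n) * ((+ 1) / suc n)
           * toℚ (((suc n) C (k ℕ.∸ 1)) ℕ.* ((suc n) C k) ℕ.* ((suc n) C (suc k)))

baxterSeq : Seq
baxterSeq i = B (suc i)

{-# OPTIONS --safe #-}
-- With β n = B_{n+1}, creative telescoping gives a three-term recurrence for β, so the ratio
-- ρ = β(n+1)/β(n) satisfies ρ(n+1) = p(n) + q(n)/ρ(n) with p → 7, q → 8. This iteration contracts
-- near its fixed point 8, which forces an asymptotic expansion of ρ in powers of 1/n to every order.
-- If 𝓛 a (n) = n⁻² s(n) a(n+1)² where s has such expansions with limit c > 0, then 𝓛 a has the same
-- property with limit 2c + 2; hence every iterate of 𝓛 is eventually positive.
-- For 2-log-convexity, ρ is enclosed for n ≥ 1 between two explicit rational functions by induction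
-- on the recurrence, and the claim becomes the nonnegativity of polynomials all of whose
-- coefficients at n = 1 are nonnegative.
module Submission where

open import Defs
open import Data.Bool using (Bool; true; false; T)
open import Data.Empty using (⊥-elim)
open import Data.Integer as ℤ using (ℤ; +_; -[1+_]; _⊖_)
import Data.Integer.Properties as ℤP
open import Data.List using (List; []; _∷_; map; applyUpTo)
open import Data.Nat as ℕ using (ℕ; zero; suc; _!)
import Data.Nat.Properties as ℕP
open import Data.Nat.Combinatorics using (_C_; nCk≡n!/k![n-k]!; k>n⇒nCk≡0; k![n∸k]!∣n!)
open import Data.Nat.DivMod using (m/n*n≡m)
open import Data.Product using (_×_; _,_; proj₁; proj₂; Σ-syntax; ∃-syntax)
open import Data.Rational
open import Data.Rational.Properties
import Data.Rational.Unnormalised as ℚᵘ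
import Data.Rational.Unnormalised.Properties as ℚᵘP
open import Data.Sum using (inj₁; inj₂)
open import Function using (_∘_; id)
open import Relation.Binary.PropositionalEquality
  using (_≡_; refl; sym; trans; cong; cong₂; subst; subst₂; module ≡-Reasoning)
open import Relation.Nullary using (yes; no)
open import Relation.Nullary.Decidable using (dec⇒maybe; toWitness)
open import Tactic.RingSolver using (solve-∀)
open import Tactic.RingSolver.Core.AlmostCommutativeRing using (AlmostCommutativeRing; fromCommutativeRing)

-- Rational arithmetic

-- Expansions to every order are needed because each application of `𝓛` costs two of them: it
-- compares second differences with x². The map c ↦ 2c + 2 arises by splitting n⁻² s(n) a(n+1)² into
-- factors f and multiplying the quotients f(n) f(n+2) / f(n+1)² = 1 + O(n⁻²): n⁻² contributes 2,
-- a(n+1)² contributes 2c, and s contributes 0, its second difference being o(n⁻²). For the Baxter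
-- numbers the start is c = 4: the ratio behaves like 8 - 32/n, its increments like 32/n², and 32/8
-- = 4. Two facts shape the finite part. The map r ↦ 7 + 8/r is decreasing, so a lower bound for ρ
-- follows only from an upper bound one index earlier and conversely; both enclosing functions must
-- be found together. And the enclosure must be sharp to order n⁻⁴: 𝓛 β(n)/β(n+1)² has size 4n⁻²,
-- and the second iterate leaves only a relative margin of 10n⁻² (that is 2c + 2), which an
-- enclosure loose at order n⁻³ would use up.

ℚ-ring : AlmostCommutativeRing _ _
ℚ-ring = fromCommutativeRing +-*-commutativeRing (λ x → dec⇒maybe (0ℚ ≟ x))

ι : ℤ → ℚ
ι z = z / 1

ι-+ : ∀ a b → ι (a ℤ.+ b) ≡ ι a + ι b
ι-+ a b = toℚᵘ-injective (begin-equality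
  toℚᵘ (ι (a ℤ.+ b))                   ≃⟨ toℚᵘ-fromℚᵘ (ℚᵘ.mkℚᵘ (a ℤ.+ b) 0) ⟩
  ℚᵘ.mkℚᵘ (a ℤ.+ b) 0                  ≃⟨ ℚᵘ.*≡* (cong (ℤ._* + 1) (sym (cong₂ ℤ._+_ (ℤP.*-identityʳ a) (ℤP.*-identityʳ b)))) ⟩
  ℚᵘ.mkℚᵘ a 0 ℚᵘ.+ ℚᵘ.mkℚᵘ b 0         ≃⟨ ℚᵘP.≃-sym (ℚᵘP.+-cong (toℚᵘ-fromℚᵘ (ℚᵘ.mkℚᵘ a 0)) (toℚᵘ-fromℚᵘ (ℚᵘ.mkℚᵘ b 0))) ⟩
  toℚᵘ (ι a) ℚᵘ.+ toℚᵘ (ι b)           ≃⟨ ℚᵘP.≃-sym (toℚᵘ-homo-+ (ι a) (ι b)) ⟩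
  toℚᵘ (ι a + ι b)                     ∎)
  where open ℚᵘP.≤-Reasoning

ι-* : ∀ a b → ι (a ℤ.* b) ≡ ι a * ι b
ι-* a b = toℚᵘ-injective (begin-equality
  toℚᵘ (ι (a ℤ.* b))                   ≃⟨ toℚᵘ-fromℚᵘ (ℚᵘ.mkℚᵘ (a ℤ.* b) 0) ⟩
  ℚᵘ.mkℚᵘ a 0 ℚᵘ.* ℚᵘ.mkℚᵘ b 0         ≃⟨ ℚᵘP.≃-sym (ℚᵘP.*-cong (toℚᵘ-fromℚᵘ (ℚᵘ.mkℚᵘ a 0)) (toℚᵘ-fromℚᵘ (ℚᵘ.mkℚᵘ b 0))) ⟩
  toℚᵘ (ι a) ℚᵘ.* toℚᵘ (ι b)           ≃⟨ ℚᵘP.≃-sym (toℚᵘ-homo-* (ι a) (ι b)) ⟩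
  toℚᵘ (ι a * ι b)                     ∎)
  where open ℚᵘP.≤-Reasoning

toℚ-+ : ∀ m n → toℚ (m ℕ.+ n) ≡ toℚ m + toℚ n
toℚ-+ m n = ι-+ (+ m) (+ n)

toℚ-* : ∀ m n → toℚ (m ℕ.* n) ≡ toℚ m * toℚ n
toℚ-* m n = trans (cong ι (ℤP.pos-* m n)) (ι-* (+ m) (+ n))

toℚ-suc : ∀ n → toℚ (suc n) ≡ toℚ n + 1ℚ
toℚ-suc n = trans (cong toℚ (ℕP.+-comm 1 n)) (toℚ-+ n 1)

ι-mono-≤ : ∀ {a b} → a ℤ.≤ b → ι a ≤ ι b
ι-mono-≤ {a} {b} a≤b = toℚᵘ-cancel-≤ (begin
  toℚᵘ (ι a)      ≃⟨ toℚᵘ-fromℚᵘ (ℚᵘ.mkℚᵘ a 0) ⟩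
  ℚᵘ.mkℚᵘ a 0     ≤⟨ ℚᵘ.*≤* (ℤP.*-monoʳ-≤-nonNeg (+ 1) a≤b) ⟩
  ℚᵘ.mkℚᵘ b 0     ≃⟨ ℚᵘP.≃-sym (toℚᵘ-fromℚᵘ (ℚᵘ.mkℚᵘ b 0)) ⟩
  toℚᵘ (ι b)      ∎)
  where open ℚᵘP.≤-Reasoning

toℚ-mono-≤ : ∀ {m n} → m ℕ.≤ n → toℚ m ≤ toℚ n
toℚ-mono-≤ {m} {n} m≤n = ι-mono-≤ {+ m} {+ n} (ℤ.+≤+ m≤n)

0≤toℚ : ∀ n → 0ℚ ≤ toℚ n
0≤toℚ n = toℚ-mono-≤ {0} {n} ℕ.z≤n

n/d*d≡n : ∀ n d .{{_ : ℕ.NonZero d}} → (n / d) * toℚ d ≡ ι n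
n/d*d≡n n d@(suc d-1) = toℚᵘ-injective (begin-equality
  toℚᵘ (n / d * toℚ d)                ≃⟨ toℚᵘ-homo-* (n / d) (toℚ d) ⟩
  toℚᵘ (n / d) ℚᵘ.* toℚᵘ (toℚ d)      ≃⟨ ℚᵘP.*-cong (toℚᵘ-fromℚᵘ (ℚᵘ.mkℚᵘ n d-1)) (toℚᵘ-fromℚᵘ (ℚᵘ.mkℚᵘ (+ d) 0)) ⟩
  ℚᵘ.mkℚᵘ n d-1 ℚᵘ.* ℚᵘ.mkℚᵘ (+ d) 0  ≃⟨ ℚᵘ.*≡* (trans (ℤP.*-identityʳ (n ℤ.* + d)) (cong (λ k → n ℤ.* + k) (sym (ℕP.*-identityʳ d)))) ⟩
  ℚᵘ.mkℚᵘ n 0                         ≃⟨ ℚᵘP.≃-sym (toℚᵘ-fromℚᵘ (ℚᵘ.mkℚᵘ n 0)) ⟩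
  toℚᵘ (ι n)                          ∎)
  where open ℚᵘP.≤-Reasoning

p≤q⇒0≤q-p : ∀ {p q} → p ≤ q → 0ℚ ≤ q - p
p≤q⇒0≤q-p {p} {q} p≤q = subst (_≤ q - p) (+-inverseʳ p) (+-monoˡ-≤ (- p) p≤q)

0≤q-p⇒p≤q : ∀ {p q} → 0ℚ ≤ q - p → p ≤ q
0≤q-p⇒p≤q {p} {q} 0≤q-p = subst₂ _≤_ (+-identityˡ p) (eq p q) (+-monoˡ-≤ p 0≤q-p)
  where
  eq : ∀ p q → q - p + p ≡ q
  eq = solve-∀ ℚ-ring

+-nonNeg : ∀ {p q} → 0ℚ ≤ p → 0ℚ ≤ q → 0ℚ ≤ p + q
+-nonNeg = +-mono-≤

*-nonNeg : ∀ {p q} → 0ℚ ≤ p → 0ℚ ≤ q → 0ℚ ≤ p * q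
*-nonNeg {p} {q} 0≤p 0≤q =
  nonNegative⁻¹ _ {{nonNeg*nonNeg⇒nonNeg p {{nonNegative 0≤p}} q {{nonNegative 0≤q}}}}

*-pos : ∀ {p q} → 0ℚ < p → 0ℚ < q → 0ℚ < p * q
*-pos {p} {q} 0<p 0<q = positive⁻¹ _ {{pos*pos⇒pos p {{positive 0<p}} q {{positive 0<q}}}}

*-monoˡ : ∀ {r p q} → 0ℚ ≤ r → p ≤ q → r * p ≤ r * q
*-monoˡ {r} 0≤r = *-monoˡ-≤-nonNeg r {{nonNegative 0≤r}}

*-monoʳ : ∀ {r p q} → 0ℚ ≤ r → p ≤ q → p * r ≤ q * r
*-monoʳ {r} 0≤r = *-monoʳ-≤-nonNeg r {{nonNegative 0≤r}}

*-mono : ∀ {p q r s} → 0ℚ ≤ q → 0ℚ ≤ r → p ≤ q → r ≤ s → p * r ≤ q * s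
*-mono 0≤q 0≤r p≤q r≤s = ≤-trans (*-monoʳ 0≤r p≤q) (*-monoˡ 0≤q r≤s)

*-cancelˡ : ∀ {r p q} → 0ℚ < r → r * p ≤ r * q → p ≤ q
*-cancelˡ {r} 0<r = *-cancelˡ-≤-pos r {{positive 0<r}}

inverse : ∀ p → 0ℚ < p → Σ[ q ∈ ℚ ] 0ℚ < q × p * q ≡ 1ℚ
inverse p 0<p = (1/ p) {{p≢0}} , positive⁻¹ _ {{1/pos⇒pos p {{0<p⁺}}}} , *-inverseʳ p {{p≢0}}
  where
  0<p⁺ = positive 0<p
  p≢0 = pos⇒nonZero p {{0<p⁺}}

archimedean : ∀ p → ∃[ N ] p ≤ toℚ N
archimedean p@(mkℚ n d-1 _) = ℤ.∣ n ∣ , toℚᵘ-cancel-≤ (begin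
  ℚᵘ.mkℚᵘ n d-1              ≤⟨ ℚᵘ.*≤* (num n) ⟩
  ℚᵘ.mkℚᵘ (+ ℤ.∣ n ∣) 0      ≃⟨ ℚᵘP.≃-sym (toℚᵘ-fromℚᵘ (ℚᵘ.mkℚᵘ (+ ℤ.∣ n ∣) 0)) ⟩
  toℚᵘ (toℚ ℤ.∣ n ∣)         ∎)
  where
  open ℚᵘP.≤-Reasoning
  num : ∀ n → n ℤ.* + 1 ℤ.≤ + ℤ.∣ n ∣ ℤ.* + suc d-1
  num (+ n) = subst₂ ℤ._≤_ (ℤP.pos-* n 1) (ℤP.pos-* n (suc d-1)) (ℤ.+≤+ (ℕP.*-monoʳ-≤ n (ℕ.s≤s ℕ.z≤n)))
  num -[1+ n ] = ℤ.-≤+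

-- The recurrence of the Baxter numbers

-- 1 / z!, extended by 0 to negative z: the recursion 1/(z-1)! = z · 1/z! then holds for all
-- integers, so that binomial identities need no boundary cases.
rfact : ℤ → ℚ
rfact (+ zero)     = 1ℚ
rfact (+ suc n)    = rfact (+ n) * (+ 1 / suc n)
rfact -[1+ n ]   = 0ℚ

rfact-pred : ∀ z → rfact z ≡ ι (ℤ.suc z) * rfact (ℤ.suc z)
rfact-pred (+ n) = begin
  rfact (+ n)                                        ≡⟨ *-identityˡ _ ⟨
  1ℚ * rfact (+ n)                                   ≡⟨ cong (_* rfact (+ n)) (n/d*d≡n (+ 1) (suc n)) ⟨
  (+ 1 / suc n) * toℚ (suc n) * rfact (+ n)          ≡⟨ eq (+ 1 / suc n) (toℚ (suc n)) (rfact (+ n)) ⟩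
  toℚ (suc n) * (rfact (+ n) * (+ 1 / suc n))        ∎
  where
  open ≡-Reasoning
  eq : ∀ p q r → p * q * r ≡ q * (r * p)
  eq = solve-∀ ℚ-ring
-- The boundary between the two branches: at z = -1 the factor z + 1 is 0, which absorbs 1/0! = 1.
rfact-pred -[1+ zero ]  = refl
rfact-pred -[1+ suc n ] = sym (*-zeroʳ (ι -[1+ n ]))

n!*rfact[n] : ∀ n → toℚ (n !) * rfact (+ n) ≡ 1ℚ
n!*rfact[n] zero    = refl
n!*rfact[n] (suc n) = begin
  toℚ (suc n ℕ.* n !) * rfact (+ suc n)                      ≡⟨ cong (_* rfact (+ suc n)) (toℚ-* (suc n) (n !)) ⟩
  toℚ (suc n) * toℚ (n !) * (rfact (+ n) * (+ 1 / suc n))    ≡⟨ eq (toℚ (suc n)) (toℚ (n !)) (rfact (+ n)) (+ 1 / suc n) ⟩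
  (toℚ (n !) * rfact (+ n)) * ((+ 1 / suc n) * toℚ (suc n))  ≡⟨ cong₂ _*_ (n!*rfact[n] n) (n/d*d≡n (+ 1) (suc n)) ⟩
  1ℚ                                                      ∎
  where
  open ≡-Reasoning
  eq : ∀ p q r s → p * q * (r * s) ≡ (q * r) * (s * p)
  eq = solve-∀ ℚ-ring

-- `n ⊖ k` keeps the sign of n - k, so for k > n the reciprocal factorial on the right is 0, as the
-- binomial is.
nCk-factorials : ∀ n k → toℚ (n C k) ≡ toℚ (n !) * (rfact (+ k) * rfact (n ⊖ k))
nCk-factorials n k with k ℕP.≤? n
... | yes k≤n = begin
  c                                                ≡⟨ *-identityʳ c ⟨
  c * (1ℚ * 1ℚ)                                    ≡⟨ cong (c *_) (cong₂ _*_ (n!*rfact[n] k) (n!*rfact[n] l)) ⟨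
  c * ((a * rfact (+ k)) * (b * rfact (+ l)))            ≡⟨ eq c a (rfact (+ k)) b (rfact (+ l)) ⟩
  c * (a * b) * (rfact (+ k) * rfact (+ l))              ≡⟨ cong₂ (λ u v → u * (rfact (+ k) * rfact v)) cab≡n! (sym (ℤP.⊖-≥ k≤n)) ⟩
  toℚ (n !) * (rfact (+ k) * rfact (n ⊖ k))              ∎
  where
  open ≡-Reasoning
  l = n ℕ.∸ k
  c = toℚ (n C k)
  a = toℚ (k !)
  b = toℚ (l !)
  instance _ = k ℕP.!* l !≢0
  eq : ∀ c a r b s → c * ((a * r) * (b * s)) ≡ c * (a * b) * (r * s)
  eq = solve-∀ ℚ-ring
  cab≡n! : c * (a * b) ≡ toℚ (n !)
  cab≡n! = begin
    c * (a * b)                         ≡⟨ cong (c *_) (toℚ-* (k !) (l !)) ⟨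
    c * toℚ (k ! ℕ.* l !)               ≡⟨ toℚ-* (n C k) (k ! ℕ.* l !) ⟨
    toℚ ((n C k) ℕ.* (k ! ℕ.* l !))     ≡⟨ cong (λ m → toℚ (m ℕ.* (k ! ℕ.* l !))) (nCk≡n!/k![n-k]! k≤n) ⟩
    toℚ ((n ! ℕ./ (k ! ℕ.* l !)) ℕ.* (k ! ℕ.* l !))  ≡⟨ cong toℚ (m/n*n≡m (k![n∸k]!∣n! k≤n)) ⟩
    toℚ (n !)                           ∎
... | no k≰n = begin
  toℚ (n C k)                            ≡⟨ cong toℚ (k>n⇒nCk≡0 (ℕP.≰⇒> k≰n)) ⟩
  0ℚ                                     ≡⟨ eq (toℚ (n !)) (rfact (+ k)) ⟩
  toℚ (n !) * (rfact (+ k) * 0ℚ)            ≡⟨ cong (λ z → toℚ (n !) * (rfact (+ k) * z)) (rfact-neg (k ℕ.∸ n) (ℕP.m<n⇒0<n∸m (ℕP.≰⇒> k≰n))) ⟨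
  toℚ (n !) * (rfact (+ k) * rfact (ℤ.- + (k ℕ.∸ n)))   ≡⟨ cong (λ z → toℚ (n !) * (rfact (+ k) * rfact z)) (ℤP.⊖-< (ℕP.≰⇒> k≰n)) ⟨
  toℚ (n !) * (rfact (+ k) * rfact (n ⊖ k))    ∎
  where
  open ≡-Reasoning
  eq : ∀ p q → 0ℚ ≡ p * (q * 0ℚ)
  eq = solve-∀ ℚ-ring
  rfact-neg : ∀ m → 0 ℕ.< m → rfact (ℤ.- + m) ≡ 0ℚ
  rfact-neg (suc m) _ = refl

-- Finite sums and telescoping

∑< : ℕ → Seq → ℚ
∑< zero    f = 0ℚ
∑< (suc n) f = f 0 + ∑< n (f ∘ suc)

∑<-cong : ∀ n {f g : Seq} → (∀ k → f k ≡ g k) → ∑< n f ≡ ∑< n g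
∑<-cong zero    eq = refl
∑<-cong (suc n) eq = cong₂ _+_ (eq 0) (∑<-cong n (eq ∘ suc))

∑<-linear : ∀ n a b c (f g h : Seq) →
            a * ∑< n f - b * ∑< n g - c * ∑< n h ≡ ∑< n (λ k → a * f k - b * g k - c * h k)
∑<-linear zero    a b c f g h = eq a b c
  where
  eq : ∀ a b c → a * 0ℚ - b * 0ℚ - c * 0ℚ ≡ 0ℚ
  eq = solve-∀ ℚ-ring
∑<-linear (suc n) a b c f g h = trans
  (eq a b c (f 0) (g 0) (h 0) (∑< n (f ∘ suc)) (∑< n (g ∘ suc)) (∑< n (h ∘ suc)))
  (cong (_+_ (a * f 0 - b * g 0 - c * h 0)) (∑<-linear n a b c (f ∘ suc) (g ∘ suc) (h ∘ suc)))
  where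
  eq : ∀ a b c f g h F G H → a * (f + F) - b * (g + G) - c * (h + H) ≡
                             (a * f - b * g - c * h) + (a * F - b * G - c * H)
  eq = solve-∀ ℚ-ring

∑<-telescope : ∀ n (f : Seq) → ∑< n (λ k → f (suc k) - f k) ≡ f n - f 0
∑<-telescope zero    f = sym (+-inverseʳ (f 0))
∑<-telescope (suc n) f = trans (cong (λ s → f 1 - f 0 + s) (∑<-telescope n (f ∘ suc))) (eq (f 0) (f 1) (f (suc n)))
  where
  eq : ∀ a b c → b - a + (c - b) ≡ c - a
  eq = solve-∀ ℚ-ring

∑<-snoc : ∀ n (f : Seq) → f n ≡ 0ℚ → ∑< (suc n) f ≡ ∑< n f
∑<-snoc zero    f fn≡0 = trans (+-identityʳ (f 0)) fn≡0
∑<-snoc (suc n) f fn≡0 = cong (_+_ (f 0)) (∑<-snoc n (f ∘ suc) fn≡0)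

sumℚ-map-upTo : ∀ n (f : ℕ → ℚ) (g h : ℕ → ℕ) → sumℚ (map f (map g (applyUpTo h n))) ≡ ∑< n (f ∘ g ∘ h)
sumℚ-map-upTo zero    f g h = refl
sumℚ-map-upTo (suc n) f g h = cong (_+_ (f (g (h 0)))) (sumℚ-map-upTo n f g (h ∘ suc))

-- With the summation index lowered by one, the product of the three binomials in B_{i+1} is (i+2)!³
-- · `lower k` · `upper i k`. Grouping the reciprocal factorials this way makes every shift of i or
-- k a multiplication by a cubic polynomial.
lower : ℕ → ℚ
upper : ℕ → ℕ → ℚ
lower k = rfact (+ k) * rfact (+ suc k) * rfact (+ suc (suc k))
upper i k = rfact (i ⊖ k) * rfact (suc i ⊖ k) * rfact (suc (suc i) ⊖ k)

lower-suc : ∀ k → let x = toℚ k in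
            lower k ≡ (x + 1ℚ) * (x + toℚ 2) * (x + toℚ 3) * lower (suc k)
lower-suc k = begin
  rfact (+ k) * rfact (+ suc k) * rfact (+ suc (suc k))
    ≡⟨ cong₂ _*_ (cong₂ _*_ (rfact-pred (+ k)) (rfact-pred (+ suc k))) (rfact-pred (+ suc (suc k))) ⟩
  (toℚ (suc k) * rfact (+ suc k)) * (toℚ (suc (suc k)) * rfact (+ suc (suc k))) * (toℚ (suc (suc (suc k))) * rfact (+ suc (suc (suc k))))
    ≡⟨ eq (toℚ (suc k)) (toℚ (suc (suc k))) (toℚ (suc (suc (suc k)))) (rfact (+ suc k)) (rfact (+ suc (suc k))) (rfact (+ suc (suc (suc k)))) ⟩
  toℚ (suc k) * toℚ (suc (suc k)) * toℚ (suc (suc (suc k))) * lower (suc k)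
    ≡⟨ cong (_* lower (suc k)) (cong₂ _*_ (cong₂ _*_ (add 1) (add 2)) (add 3)) ⟩
  (x + 1ℚ) * (x + toℚ 2) * (x + toℚ 3) * lower (suc k)  ∎
  where
  open ≡-Reasoning
  x = toℚ k
  add : ∀ d → toℚ (d ℕ.+ k) ≡ x + toℚ d
  add d = trans (cong toℚ (ℕP.+-comm d k)) (toℚ-+ k d)
  eq : ∀ a b c p q r → (a * p) * (b * q) * (c * r) ≡ a * b * c * (p * q * r)
  eq = solve-∀ ℚ-ring

suc-⊖ : ∀ m n → ℤ.suc (m ⊖ n) ≡ suc m ⊖ n
suc-⊖ m n = ℤP.distribʳ-⊖-+-pos 1 m n

ι-⊖ : ∀ d m n → ι (d ℕ.+ m ⊖ n) ≡ toℚ m - toℚ n + toℚ d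
ι-⊖ d m n = begin
  ι (d ℕ.+ m ⊖ n)             ≡⟨ +-identityʳ (ι (d ℕ.+ m ⊖ n)) ⟨
  ι (d ℕ.+ m ⊖ n) + 0ℚ        ≡⟨ cong (_+_ (ι (d ℕ.+ m ⊖ n))) (+-inverseʳ (toℚ n)) ⟨
  ι (d ℕ.+ m ⊖ n) + (toℚ n - toℚ n)  ≡⟨ +-assoc (ι (d ℕ.+ m ⊖ n)) (toℚ n) (- toℚ n) ⟨
  ι (d ℕ.+ m ⊖ n) + toℚ n - toℚ n  ≡⟨ cong (_- toℚ n) (ι-+ (d ℕ.+ m ⊖ n) (+ n)) ⟨
  ι (d ℕ.+ m ⊖ n ℤ.+ + n) - toℚ n  ≡⟨ cong (λ z → ι z - toℚ n) (ℤP.distribˡ-⊖-+-pos n (d ℕ.+ m) n) ⟩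
  ι (d ℕ.+ m ℕ.+ n ⊖ n) - toℚ n    ≡⟨ cong (λ z → ι z - toℚ n) (trans (ℤP.⊖-≥ (ℕP.m≤n+m n (d ℕ.+ m))) (cong +_ (ℕP.m+n∸n≡m (d ℕ.+ m) n))) ⟩
  toℚ (d ℕ.+ m) - toℚ n            ≡⟨ cong (_- toℚ n) (toℚ-+ d m) ⟩
  toℚ d + toℚ m - toℚ n            ≡⟨ eq (toℚ d) (toℚ m) (toℚ n) ⟩
  toℚ m - toℚ n + toℚ d            ∎
  where
  open ≡-Reasoning
  eq : ∀ a b c → a + b - c ≡ b - c + a
  eq = solve-∀ ℚ-ring

upper-suc : ∀ i k → let y = toℚ i - toℚ k in
            upper i k ≡ (y + 1ℚ) * (y + toℚ 2) * (y + toℚ 3) * upper (suc i) k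
upper-suc i k = begin
  rfact (i ⊖ k) * rfact (suc i ⊖ k) * rfact (suc (suc i) ⊖ k)
    ≡⟨ cong₂ _*_ (cong₂ _*_ (step 0) (step 1)) (step 2) ⟩
  ((y + 1ℚ) * rfact (suc i ⊖ k)) * ((y + toℚ 2) * rfact (suc (suc i) ⊖ k)) * ((y + toℚ 3) * rfact (suc (suc (suc i)) ⊖ k))
    ≡⟨ eq (y + 1ℚ) (y + toℚ 2) (y + toℚ 3) (rfact (suc i ⊖ k)) (rfact (suc (suc i) ⊖ k)) (rfact (suc (suc (suc i)) ⊖ k)) ⟩
  (y + 1ℚ) * (y + toℚ 2) * (y + toℚ 3) * upper (suc i) k  ∎
  where
  open ≡-Reasoning
  y = toℚ i - toℚ k
  step : ∀ d → rfact (d ℕ.+ i ⊖ k) ≡ (y + toℚ (suc d)) * rfact (suc d ℕ.+ i ⊖ k)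
  step d = begin
    rfact (d ℕ.+ i ⊖ k)                                ≡⟨ rfact-pred (d ℕ.+ i ⊖ k) ⟩
    ι (ℤ.suc (d ℕ.+ i ⊖ k)) * rfact (ℤ.suc (d ℕ.+ i ⊖ k))  ≡⟨ cong (λ z → ι z * rfact z) (suc-⊖ (d ℕ.+ i) k) ⟩
    ι (suc d ℕ.+ i ⊖ k) * rfact (suc d ℕ.+ i ⊖ k)      ≡⟨ cong (_* rfact (suc d ℕ.+ i ⊖ k)) (ι-⊖ (suc d) i k) ⟩
    (y + toℚ (suc d)) * rfact (suc d ℕ.+ i ⊖ k)        ∎
  eq : ∀ a b c p q r → (a * p) * (b * q) * (c * r) ≡ a * b * c * (p * q * r)
  eq = solve-∀ ℚ-ring

!³ : ℕ → ℚ
!³ i = toℚ (i !) * toℚ (suc i !) * toℚ (suc (suc i) !)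

summand : ℕ → ℕ → ℚ
summand i k = toℚ 2 * !³ i * (lower k * upper i k)

!-suc : ∀ n → toℚ (suc n !) ≡ toℚ (suc n) * toℚ (n !)
!-suc n = toℚ-* (suc n) (n !)

!³-suc : ∀ i → let x = toℚ i in !³ (suc i) ≡ (x + 1ℚ) * (x + toℚ 2) * (x + toℚ 3) * !³ i
!³-suc i = begin
  toℚ (suc i !) * toℚ (suc (suc i) !) * toℚ (suc (suc (suc i)) !)
    ≡⟨ cong₂ _*_ (cong₂ _*_ (step 0) (step 1)) (step 2) ⟩
  ((x + 1ℚ) * a) * ((x + toℚ 2) * b) * ((x + toℚ 3) * c)
    ≡⟨ eq (x + 1ℚ) (x + toℚ 2) (x + toℚ 3) a b c ⟩
  (x + 1ℚ) * (x + toℚ 2) * (x + toℚ 3) * !³ i  ∎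
  where
  open ≡-Reasoning
  x = toℚ i
  a = toℚ (i !)
  b = toℚ (suc i !)
  c = toℚ (suc (suc i) !)
  step : ∀ d → toℚ (suc (d ℕ.+ i) !) ≡ (x + toℚ (suc d)) * toℚ ((d ℕ.+ i) !)
  step d = trans (!-suc (d ℕ.+ i)) (cong (_* toℚ ((d ℕ.+ i) !)) (trans (cong toℚ (ℕP.+-comm (suc d) i)) (toℚ-+ i (suc d))))
  eq : ∀ a b c p q r → (a * p) * (b * q) * (c * r) ≡ a * b * c * (p * q * r)
  eq = solve-∀ ℚ-ring

-- The prefactor 2/((i+1)(i+2)²) cancels against (i+2)!³ and leaves 2 · i! (i+1)! (i+2)!.
baxter-term : ∀ i k → let m = suc (suc i) in
  ((+ 2) / suc i) * ((+ 1) / m) * ((+ 1) / m) * toℚ ((m C k) ℕ.* (m C suc k) ℕ.* (m C suc (suc k))) ≡ summand i k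
baxter-term i k = begin
  a * e * e * toℚ ((m C k) ℕ.* (m C suc k) ℕ.* (m C suc (suc k)))
    ≡⟨ cong (a * e * e *_) (trans (toℚ-* ((m C k) ℕ.* (m C suc k)) (m C suc (suc k))) (cong (_* toℚ (m C suc (suc k))) (toℚ-* (m C k) (m C suc k)))) ⟩
  a * e * e * (toℚ (m C k) * toℚ (m C suc k) * toℚ (m C suc (suc k)))
    ≡⟨ cong (a * e * e *_) (cong₂ _*_ (cong₂ _*_ (nCk-factorials m k) (nCk-factorials m (suc k))) (nCk-factorials m (suc (suc k)))) ⟩
  a * e * e * ((M * (p₀ * rfact (m ⊖ k))) * (M * (p₁ * rfact (m ⊖ suc k))) * (M * (p₂ * rfact (m ⊖ suc (suc k)))))
    ≡⟨ cong₂ (λ u v → a * e * e * ((M * (p₀ * q₂)) * (M * (p₁ * u)) * (M * (p₂ * v))))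
         (cong rfact (ℤP.[1+m]⊖[1+n]≡m⊖n (suc i) k))
         (cong rfact (trans (ℤP.[1+m]⊖[1+n]≡m⊖n (suc i) (suc k)) (ℤP.[1+m]⊖[1+n]≡m⊖n i k))) ⟩
  a * e * e * ((M * (p₀ * q₂)) * (M * (p₁ * q₁)) * (M * (p₂ * q₀)))
    ≡⟨ eq₁ a e M p₀ p₁ p₂ q₀ q₁ q₂ ⟩
  (a * e * e * M * M) * M * (lower k * upper i k)
    ≡⟨ cong (λ z → z * M * (lower k * upper i k)) fac ⟩
  toℚ 2 * toℚ (i !) * toℚ (suc i !) * M * (lower k * upper i k)
    ≡⟨ eq₂ (toℚ (i !)) (toℚ (suc i !)) M (lower k * upper i k) ⟩
  summand i k ∎
  where
  open ≡-Reasoning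
  m = suc (suc i)
  a = (+ 2) / suc i
  e = (+ 1) / m
  M = toℚ (m !)
  p₀ = rfact (+ k)
  p₁ = rfact (+ suc k)
  p₂ = rfact (+ suc (suc k))
  q₀ = rfact (i ⊖ k)
  q₁ = rfact (suc i ⊖ k)
  q₂ = rfact (m ⊖ k)
  eq₁ : ∀ a e M p₀ p₁ p₂ q₀ q₁ q₂ → a * e * e * ((M * (p₀ * q₂)) * (M * (p₁ * q₁)) * (M * (p₂ * q₀))) ≡
        (a * e * e * M * M) * M * (p₀ * p₁ * p₂ * (q₀ * q₁ * q₂))
  eq₁ = solve-∀ ℚ-ring
  eq₂ : ∀ x y z w → toℚ 2 * x * y * z * w ≡ toℚ 2 * (x * y * z) * w
  eq₂ = solve-∀ ℚ-ring
  eq₃ : ∀ a e s t x y → a * e * e * (t * y) * (t * (s * x)) ≡ (a * s) * x * y * ((e * t) * (e * t))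
  eq₃ = solve-∀ ℚ-ring
  fac : a * e * e * M * M ≡ toℚ 2 * toℚ (i !) * toℚ (suc i !)
  fac = begin
    a * e * e * M * M
      ≡⟨ cong₂ (λ u v → a * e * e * u * v) (!-suc (suc i)) (trans (!-suc (suc i)) (cong (toℚ m *_) (!-suc i))) ⟩
    a * e * e * (toℚ m * toℚ (suc i !)) * (toℚ m * (toℚ (suc i) * toℚ (i !)))
      ≡⟨ eq₃ a e (toℚ (suc i)) (toℚ m) (toℚ (i !)) (toℚ (suc i !)) ⟩
    (a * toℚ (suc i)) * toℚ (i !) * toℚ (suc i !) * ((e * toℚ m) * (e * toℚ m))
      ≡⟨ cong₂ (λ u v → u * toℚ (i !) * toℚ (suc i !) * (v * v)) (n/d*d≡n (+ 2) (suc i)) (n/d*d≡n (+ 1) m) ⟩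
    toℚ 2 * toℚ (i !) * toℚ (suc i !) * (1ℚ * 1ℚ)
      ≡⟨ *-identityʳ (toℚ 2 * toℚ (i !) * toℚ (suc i !)) ⟩
    toℚ 2 * toℚ (i !) * toℚ (suc i !) ∎

baxter≡∑ : ∀ i → baxterSeq i ≡ ∑< (suc i) (summand i)
baxter≡∑ i = trans (sumℚ-map-upTo (suc i) term suc id) (∑<-cong (suc i) (baxter-term i))
  where
  m = suc (suc i)
  term : ℕ → ℚ
  term k = ((+ 2) / suc i) * ((+ 1) / m) * ((+ 1) / m) * toℚ ((m C (k ℕ.∸ 1)) ℕ.* (m C k) ℕ.* (m C suc k))

summand-vanishes : ∀ d i → summand i (suc d ℕ.+ i) ≡ 0ℚ
summand-vanishes d i = trans
  (cong (λ z → toℚ 2 * !³ i * (lower (suc d ℕ.+ i) * (z * q₁ * q₂))) (cong rfact i⊖))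
  (eq (toℚ 2 * !³ i) (lower (suc d ℕ.+ i)) q₁ q₂)
  where
  q₁ = rfact (suc i ⊖ (suc d ℕ.+ i))
  q₂ = rfact (suc (suc i) ⊖ (suc d ℕ.+ i))
  i⊖ : i ⊖ (suc d ℕ.+ i) ≡ -[1+ d ]
  i⊖ = trans (ℤP.⊖-< (ℕ.s≤s (ℕP.m≤n+m i d))) (cong (λ n → ℤ.- + n) (ℕP.m+n∸n≡m (suc d) i))
  eq : ∀ a b q₁ q₂ → a * (b * (0ℚ * q₁ * q₂)) ≡ 0ℚ
  eq = solve-∀ ℚ-ring

-- Terms with k > i contain 1/(i-k)! = 0. Padding with them lets three consecutive Baxter numbers be
-- written as sums over one common range.
∑<-summand-extend : ∀ d i → ∑< (d ℕ.+ suc i) (summand i) ≡ baxterSeq i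
∑<-summand-extend zero    i = sym (baxter≡∑ i)
∑<-summand-extend (suc d) i = trans
  (∑<-snoc (d ℕ.+ suc i) (summand i) (trans (cong (summand i) (ℕP.+-suc d i)) (summand-vanishes d i)))
  (∑<-summand-extend d i)

-- The coefficients of (n+2)(n+3) B_n = (7n² + 7n - 2) B_{n-1} + 8(n-1)(n-2) B_{n-2} at n = x + 3.
recP recQ recD : ℚ → ℚ
recP x = toℚ 7 * (x + toℚ 3) * (x + toℚ 3) + toℚ 7 * (x + toℚ 3) - toℚ 2
recQ x = toℚ 8 * (x + 1ℚ) * (x + toℚ 2)
recD x = (x + toℚ 5) * (x + toℚ 6)

-- Found by solving Zeilberger's linear system for the recurrence of the Baxter numbers.
certificate : ℚ → ℚ → ℚ
certificate x z =
  (- toℚ 804 - toℚ 2008 * x - toℚ 1867 * x * x - toℚ 822 * x * x * x - toℚ 173 * x * x * x * x - toℚ 14 * x * x * x * x * x)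
  + (toℚ 496 + toℚ 1074 * x + toℚ 797 * x * x + toℚ 246 * x * x * x + toℚ 27 * x * x * x * x) * z
  - (toℚ 108 + toℚ 198 * x + toℚ 108 * x * x + toℚ 18 * x * x * x) * z * z
  + (toℚ 8 + toℚ 12 * x + toℚ 4 * x * x) * z * z * z

-- The common hypergeometric factor of the three summands, times a polynomial. The factor
-- z(z+1)(z+2) is the quotient of `lower` at k-1 and at k; it makes the value at k = 0 vanish. At k
-- = i+3 the value vanishes because `upper (suc (suc i)) k` contains 1/(-1)!.
antidifference : ℕ → ℕ → ℚ
antidifference i k = toℚ 2 * !³ i * (lower k * upper (suc (suc i)) k) * (z * (z + 1ℚ) * (z + toℚ 2) * certificate (toℚ i) z)
  where z = toℚ k

-- What the recurrence for the summands becomes after division by 2 · `!³ i` · `lower k` ·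
-- `upper (suc (suc i)) k`. The cubic e is the effect on `upper` both of lowering i + 2 to i + 1 and
-- of raising k by one, since `upper` depends only on the difference.
certificate-identity : ∀ x z →
  let y = x - z
      e = (y + toℚ 4) * (y + toℚ 3) * (y + toℚ 2)
      P = toℚ 7 * (x + toℚ 3) * (x + toℚ 3) + toℚ 7 * (x + toℚ 3) - toℚ 2
      Q = toℚ 8 * (x + 1ℚ) * (x + toℚ 2)
      D = (x + toℚ 5) * (x + toℚ 6)
      R = λ z →
        (- toℚ 804 - toℚ 2008 * x - toℚ 1867 * x * x - toℚ 822 * x * x * x - toℚ 173 * x * x * x * x - toℚ 14 * x * x * x * x * x)
        + (toℚ 496 + toℚ 1074 * x + toℚ 797 * x * x + toℚ 246 * x * x * x + toℚ 27 * x * x * x * x) * z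
        - (toℚ 108 + toℚ 198 * x + toℚ 108 * x * x + toℚ 18 * x * x * x) * z * z
        + (toℚ 8 + toℚ 12 * x + toℚ 4 * x * x) * z * z * z
  in D * ((x + 1ℚ) * (x + toℚ 2) * (x + toℚ 2) * (x + toℚ 3) * (x + toℚ 3) * (x + toℚ 4))
     - P * ((x + 1ℚ) * (x + toℚ 2) * (x + toℚ 3) * e)
     - Q * (e * ((y + toℚ 3) * (y + toℚ 2) * (y + 1ℚ)))
     ≡ e * R (z + 1ℚ) - z * (z + 1ℚ) * (z + toℚ 2) * R z
certificate-identity = solve-∀ ℚ-ring

summand-recurrence : ∀ i k → let x = toℚ i in
  recD x * summand (suc (suc i)) k - recP x * summand (suc i) k - recQ x * summand i k
  ≡ antidifference i (suc k) - antidifference i k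
summand-recurrence i k = begin
  D * (toℚ 2 * !³ (suc (suc i)) * (lower k * u)) - P * (toℚ 2 * !³ (suc i) * (lower k * upper (suc i) k)) - Q * (toℚ 2 * f * (lower k * upper i k))
    ≡⟨ cong₂ (λ v w → D * (toℚ 2 * v * (lower k * u)) - P * (toℚ 2 * !³ (suc i) * (lower k * upper (suc i) k)) - Q * (toℚ 2 * f * (lower k * w)))
         f₂ u₀ ⟩
  D * (toℚ 2 * (s₂ * (s₁ * f)) * (lower k * u)) - P * (toℚ 2 * !³ (suc i) * (lower k * upper (suc i) k)) - Q * (toℚ 2 * f * (lower k * (v₀ * (e′ * u))))
    ≡⟨ cong₂ (λ v w → D * (toℚ 2 * (s₂ * (s₁ * f)) * (lower k * u)) - P * (toℚ 2 * v * (lower k * w)) - Q * (toℚ 2 * f * (lower k * (v₀ * (e′ * u)))))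
         (!³-suc i) u₁ ⟩
  D * (toℚ 2 * (s₂ * (s₁ * f)) * (lower k * u)) - P * (toℚ 2 * (s₁ * f) * (lower k * (e′ * u))) - Q * (toℚ 2 * f * (lower k * (v₀ * (e′ * u))))
    ≡⟨ eq₁ D P Q x y f u (lower k) ⟩
  (toℚ 2 * f * (lower k * u)) *
    (D * ((x + 1ℚ) * (x + toℚ 2) * (x + toℚ 2) * (x + toℚ 3) * (x + toℚ 3) * (x + toℚ 4))
     - P * ((x + 1ℚ) * (x + toℚ 2) * (x + toℚ 3) * e)
     - Q * (e * ((y + toℚ 3) * (y + toℚ 2) * (y + 1ℚ))))
    ≡⟨ cong (toℚ 2 * f * (lower k * u) *_) (certificate-identity x z) ⟩
  (toℚ 2 * f * (lower k * u)) * (e * certificate x (z + 1ℚ) - z * (z + 1ℚ) * (z + toℚ 2) * certificate x z)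
    ≡⟨ cong (λ v → toℚ 2 * f * (v * u) * (e * certificate x (z + 1ℚ) - z * (z + 1ℚ) * (z + toℚ 2) * certificate x z)) (lower-suc k) ⟩
  (toℚ 2 * f * (t * l * u)) * (e * certificate x (z + 1ℚ) - z * (z + 1ℚ) * (z + toℚ 2) * certificate x z)
    ≡⟨ eq₂ f l u y z (certificate x (z + 1ℚ)) (certificate x z) ⟩
  toℚ 2 * f * (l * (e′ * u)) * ((z + 1ℚ) * (z + 1ℚ + 1ℚ) * (z + 1ℚ + toℚ 2) * certificate x (z + 1ℚ))
  - toℚ 2 * f * (t * l * u) * (z * (z + 1ℚ) * (z + toℚ 2) * certificate x z)
    ≡⟨ cong₂ (λ v w → toℚ 2 * f * (l * v) * ((z + 1ℚ) * (z + 1ℚ + 1ℚ) * (z + 1ℚ + toℚ 2) * certificate x (z + 1ℚ)) - toℚ 2 * f * (w * u) * (z * (z + 1ℚ) * (z + toℚ 2) * certificate x z))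
         (trans (sym u₁) u-suc) (sym (lower-suc k)) ⟩
  toℚ 2 * f * (l * upper (suc (suc i)) (suc k)) * ((z + 1ℚ) * (z + 1ℚ + 1ℚ) * (z + 1ℚ + toℚ 2) * certificate x (z + 1ℚ))
  - antidifference i k
    ≡⟨ cong (λ v → toℚ 2 * f * (l * upper (suc (suc i)) (suc k)) * (v * (v + 1ℚ) * (v + toℚ 2) * certificate x v) - antidifference i k) (toℚ-suc k) ⟨
  antidifference i (suc k) - antidifference i k ∎
  where
  open ≡-Reasoning
  x = toℚ i
  z = toℚ k
  y = x - z
  D = recD x
  P = recP x
  Q = recQ x
  f = !³ i
  l = lower (suc k)
  u = upper (suc (suc i)) k
  e = (y + toℚ 4) * (y + toℚ 3) * (y + toℚ 2)
  e′ = (y + toℚ 2) * (y + toℚ 3) * (y + toℚ 4)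
  s₁ = (x + 1ℚ) * (x + toℚ 2) * (x + toℚ 3)
  s₂ = (x + toℚ 2) * (x + toℚ 3) * (x + toℚ 4)
  t = (z + 1ℚ) * (z + toℚ 2) * (z + toℚ 3)
  v₀ = (y + 1ℚ) * (y + toℚ 2) * (y + toℚ 3)
  f₂ : !³ (suc (suc i)) ≡ s₂ * (s₁ * f)
  f₂ = trans (!³-suc (suc i)) (cong₂ _*_ (trans (cong (λ v → (v + 1ℚ) * (v + toℚ 2) * (v + toℚ 3)) (toℚ-suc i)) (sh x)) (!³-suc i))
    where
    sh : ∀ x → (x + 1ℚ + 1ℚ) * (x + 1ℚ + toℚ 2) * (x + 1ℚ + toℚ 3) ≡ (x + toℚ 2) * (x + toℚ 3) * (x + toℚ 4)
    sh = solve-∀ ℚ-ring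
  u₁ : upper (suc i) k ≡ e′ * u
  u₁ = trans (upper-suc (suc i) k) (cong (_* u) (trans (cong (λ v → (v - z + 1ℚ) * (v - z + toℚ 2) * (v - z + toℚ 3)) (toℚ-suc i)) (sh x z)))
    where
    sh : ∀ x z → (x + 1ℚ - z + 1ℚ) * (x + 1ℚ - z + toℚ 2) * (x + 1ℚ - z + toℚ 3) ≡ (x - z + toℚ 2) * (x - z + toℚ 3) * (x - z + toℚ 4)
    sh = solve-∀ ℚ-ring
  u₀ : upper i k ≡ v₀ * (e′ * u)
  u₀ = trans (upper-suc i k) (cong (v₀ *_) u₁)
  u-suc : upper (suc i) k ≡ upper (suc (suc i)) (suc k)
  u-suc = sym (cong₂ _*_ (cong₂ _*_ (sh (suc i)) (sh (suc (suc i)))) (sh (suc (suc (suc i)))))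
    where
    sh : ∀ m → rfact (suc m ⊖ suc k) ≡ rfact (m ⊖ k)
    sh m = cong rfact (ℤP.[1+m]⊖[1+n]≡m⊖n m k)
  eq₁ : ∀ D P Q x y f u l →
    D * (toℚ 2 * (((x + toℚ 2) * (x + toℚ 3) * (x + toℚ 4)) * (((x + 1ℚ) * (x + toℚ 2) * (x + toℚ 3)) * f)) * (l * u))
    - P * (toℚ 2 * (((x + 1ℚ) * (x + toℚ 2) * (x + toℚ 3)) * f) * (l * (((y + toℚ 2) * (y + toℚ 3) * (y + toℚ 4)) * u)))
    - Q * (toℚ 2 * f * (l * (((y + 1ℚ) * (y + toℚ 2) * (y + toℚ 3)) * (((y + toℚ 2) * (y + toℚ 3) * (y + toℚ 4)) * u))))
    ≡ (toℚ 2 * f * (l * u)) *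
      (D * ((x + 1ℚ) * (x + toℚ 2) * (x + toℚ 2) * (x + toℚ 3) * (x + toℚ 3) * (x + toℚ 4))
      - P * ((x + 1ℚ) * (x + toℚ 2) * (x + toℚ 3) * ((y + toℚ 4) * (y + toℚ 3) * (y + toℚ 2)))
      - Q * (((y + toℚ 4) * (y + toℚ 3) * (y + toℚ 2)) * ((y + toℚ 3) * (y + toℚ 2) * (y + 1ℚ))))
  eq₁ = solve-∀ ℚ-ring
  eq₂ : ∀ f l u y z a b →
    (toℚ 2 * f * (((z + 1ℚ) * (z + toℚ 2) * (z + toℚ 3)) * l * u)) * (((y + toℚ 4) * (y + toℚ 3) * (y + toℚ 2)) * a - z * (z + 1ℚ) * (z + toℚ 2) * b)
    ≡ toℚ 2 * f * (l * (((y + toℚ 2) * (y + toℚ 3) * (y + toℚ 4)) * u)) * ((z + 1ℚ) * (z + 1ℚ + 1ℚ) * (z + 1ℚ + toℚ 2) * a)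
      - toℚ 2 * f * (((z + 1ℚ) * (z + toℚ 2) * (z + toℚ 3)) * l * u) * (z * (z + 1ℚ) * (z + toℚ 2) * b)
  eq₂ = solve-∀ ℚ-ring

baxter-recurrence : ∀ i → let x = toℚ i in
  recD x * baxterSeq (suc (suc i)) ≡ recP x * baxterSeq (suc i) + recQ x * baxterSeq i
baxter-recurrence i = move (D * baxterSeq (suc (suc i))) (P * baxterSeq (suc i)) (Q * baxterSeq i) (begin
  D * baxterSeq (suc (suc i)) - P * baxterSeq (suc i) - Q * baxterSeq i
    -- The sums for i+2, i+1 and i are padded by 0, 1 and 2 vanishing terms, so that all have i+3
    -- terms.
    ≡⟨ cong₂ (λ u v → D * u - P * v - Q * baxterSeq i) (∑<-summand-extend 0 (suc (suc i))) (∑<-summand-extend 1 (suc i)) ⟨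
  D * ∑< n (summand (suc (suc i))) - P * ∑< n (summand (suc i)) - Q * baxterSeq i
    ≡⟨ cong (λ u → D * ∑< n (summand (suc (suc i))) - P * ∑< n (summand (suc i)) - Q * u) (∑<-summand-extend 2 i) ⟨
  D * ∑< n (summand (suc (suc i))) - P * ∑< n (summand (suc i)) - Q * ∑< n (summand i)
    ≡⟨ ∑<-linear n D P Q (summand (suc (suc i))) (summand (suc i)) (summand i) ⟩
  ∑< n (λ k → D * summand (suc (suc i)) k - P * summand (suc i) k - Q * summand i k)
    ≡⟨ ∑<-cong n (summand-recurrence i) ⟩
  ∑< n (λ k → antidifference i (suc k) - antidifference i k)
    ≡⟨ ∑<-telescope n (antidifference i) ⟩
  antidifference i n - antidifference i 0
    ≡⟨ cong₂ _-_ top bottom ⟩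
  0ℚ ∎)
  where
  open ≡-Reasoning
  x = toℚ i
  n = suc (suc (suc i))
  D = recD x
  P = recP x
  Q = recQ x
  move : ∀ a b c → a - b - c ≡ 0ℚ → a ≡ b + c
  move a b c eq = trans (split a b c) (trans (cong (_+ (b + c)) eq) (+-identityˡ (b + c)))
    where
    split : ∀ a b c → a ≡ (a - b - c) + (b + c)
    split = solve-∀ ℚ-ring
  top : antidifference i n ≡ 0ℚ
  top = trans (cong (λ w → toℚ 2 * !³ i * (lower n * (w * q₁ * q₂)) * w′) (cong rfact (ℤP.⊖-< (ℕP.n<1+n (suc (suc i))))))
       (trans (cong (λ w → toℚ 2 * !³ i * (lower n * (rfact (ℤ.- + w) * q₁ * q₂)) * w′) (ℕP.m+n∸n≡m 1 (suc (suc i)))) (eq (toℚ 2 * !³ i) (lower n) q₁ q₂ w′))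
    where
    q₁ = rfact (n ⊖ n)
    q₂ = rfact (suc n ⊖ n)
    z = toℚ n
    w′ = z * (z + 1ℚ) * (z + toℚ 2) * certificate x z
    eq : ∀ a b q₁ q₂ w → a * (b * (0ℚ * q₁ * q₂)) * w ≡ 0ℚ
    eq = solve-∀ ℚ-ring
  bottom : antidifference i 0 ≡ 0ℚ
  bottom = eq (toℚ 2 * !³ i * (lower 0 * upper (suc (suc i)) 0)) (certificate x 0ℚ)
    where
    eq : ∀ a c → a * (0ℚ * (0ℚ + 1ℚ) * (0ℚ + toℚ 2) * c) ≡ 0ℚ
    eq = solve-∀ ℚ-ring

-- Asymptotic expansions

record Eventually (P : ℕ → Set) : Set where
  constructor _,_
  field
    from  : ℕ
    holds : ∀ n → from ℕ.≤ n → P n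

module _ {P Q : ℕ → Set} where

  ev-map : (∀ n → P n → Q n) → Eventually P → Eventually Q
  ev-map f (N , p) = N , λ n N≤n → f n (p n N≤n)

  ev-map₂ : ∀ {R : ℕ → Set} → (∀ n → P n → Q n → R n) → Eventually P → Eventually Q → Eventually R
  ev-map₂ f (M , p) (N , q) =
    M ℕ.⊔ N , λ n h → f n (p n (ℕP.m⊔n≤o⇒m≤o M N h)) (q n (ℕP.m⊔n≤o⇒n≤o M N h))

  ev-map₃ : ∀ {R S : ℕ → Set} → (∀ n → P n → Q n → R n → S n) →
            Eventually P → Eventually Q → Eventually R → Eventually S
  ev-map₃ f (M , p) (N , q) (L , r) =
    M ℕ.⊔ N ℕ.⊔ L , λ n h → let h′ = ℕP.m⊔n≤o⇒m≤o (M ℕ.⊔ N) L h in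
      f n (p n (ℕP.m⊔n≤o⇒m≤o M N h′)) (q n (ℕP.m⊔n≤o⇒n≤o M N h′)) (r n (ℕP.m⊔n≤o⇒n≤o (M ℕ.⊔ N) L h))

always : ∀ {P : ℕ → Set} → (∀ n → P n) → Eventually P
always p = 0 , λ n _ → p n

ev-suc : ∀ {P : ℕ → Set} → Eventually P → Eventually (P ∘ suc)
ev-suc (N , p) = N , λ n N≤n → p (suc n) (ℕP.m≤n⇒m≤1+n N≤n)

infix 4 _≈_
_≈_ : Seq → Seq → Set
a ≈ b = Eventually (λ n → a n ≡ b n)

infixl 6 _⊕_
infixl 7 _⊗_
_⊕_ _⊗_ : Seq → Seq → Seq
(a ⊕ b) n = a n + b n
(a ⊗ b) n = a n * b n

const : ℚ → Seq
const c _ = c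

-- The expansion variable 1/(n+1) and its quotients under shifts

x : Seq
x n = (+ 1) / suc n

-- The quotient x(n+1)/x(n) = (n+1)/(n+2). Through it, expansions of shifted sequences are written
-- in the unshifted variable.
y : Seq
y n = toℚ (suc n) * x (suc n)

n+1·x : ∀ n → toℚ (suc n) * x n ≡ 1ℚ
n+1·x n = trans (*-comm (toℚ (suc n)) (x n)) (n/d*d≡n (+ 1) (suc n))

x-suc : ∀ n → x (suc n) ≡ x n * y n
x-suc n = begin
  x (suc n)                               ≡⟨ *-identityˡ (x (suc n)) ⟨
  1ℚ * x (suc n)                          ≡⟨ cong (_* x (suc n)) (n/d*d≡n (+ 1) (suc n)) ⟨
  (x n * toℚ (suc n)) * x (suc n)         ≡⟨ *-assoc (x n) (toℚ (suc n)) (x (suc n)) ⟩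
  x n * y n                               ∎
  where open ≡-Reasoning

y-unfold : ∀ n → y n ≡ 1ℚ + x n * (- 1ℚ * y n)
y-unfold n = begin
  toℚ (suc n) * x (suc n)                        ≡⟨ eq (toℚ (suc n)) (x (suc n)) ⟩
  (toℚ (suc n) + 1ℚ) * x (suc n) - x (suc n)     ≡⟨ cong₂ (λ u v → u * x (suc n) - v) (sym (toℚ-suc (suc n))) (x-suc n) ⟩
  toℚ (suc (suc n)) * x (suc n) - x n * y n      ≡⟨ cong (_- x n * y n) (n+1·x (suc n)) ⟩
  1ℚ - x n * y n                                 ≡⟨ eq′ (x n) (y n) ⟩
  1ℚ + x n * (- 1ℚ * y n)                        ∎
  where
  open ≡-Reasoning
  eq : ∀ a b → a * b ≡ (a + 1ℚ) * b - b
  eq = solve-∀ ℚ-ring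
  eq′ : ∀ a b → 1ℚ - a * b ≡ 1ℚ + a * (- 1ℚ * b)
  eq′ = solve-∀ ℚ-ring

0<x : ∀ n → 0ℚ < x n
0<x n = positive⁻¹ (x n) {{normalize-pos 1 (suc n)}}

0<1ℚ : 0ℚ < 1ℚ
0<1ℚ = positive⁻¹ 1ℚ

x≤1 : ∀ n → x n ≤ 1ℚ
x≤1 n = subst₂ _≤_ (*-identityʳ (x n)) (n/d*d≡n (+ 1) (suc n))
  (*-monoˡ (<⇒≤ (0<x n)) (toℚ-mono-≤ {1} {suc n} (ℕ.s≤s ℕ.z≤n)))

∣x∣≡x : ∀ n → ∣ x n ∣ ≡ x n
∣x∣≡x n = 0≤p⇒∣p∣≡p (<⇒≤ (0<x n))

p≤∣p∣ : ∀ p → p ≤ ∣ p ∣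
p≤∣p∣ p with ≤-total 0ℚ p
... | inj₁ 0≤p = ≤-reflexive (sym (0≤p⇒∣p∣≡p 0≤p))
... | inj₂ p≤0 = ≤-trans p≤0 (0≤∣p∣ p)

-p≤∣p∣ : ∀ p → - p ≤ ∣ p ∣
-p≤∣p∣ p = subst (- p ≤_) (∣-p∣≡∣p∣ p) (p≤∣p∣ (- p))

∣p∣≤ : ∀ {p c} → p ≤ c → - p ≤ c → ∣ p ∣ ≤ c
∣p∣≤ {p} {c} p≤c -p≤c with ∣p∣≡p∨∣p∣≡-p p
... | inj₁ eq = subst (_≤ c) (sym eq) p≤c
... | inj₂ eq = subst (_≤ c) (sym eq) -p≤c

record Bounded (a : Seq) : Set where
  constructor _,_
  field
    bound   : ℚ
    bounds  : Eventually (λ n → ∣ a n ∣ ≤ bound)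

open Bounded

0≤bound : ∀ {a} (b : Bounded a) → 0ℚ ≤ bound b
0≤bound {a} (M , (N , h)) = ≤-trans (0≤∣p∣ (a N)) (h N ℕP.≤-refl)

bounded-+ : ∀ {a b} → Bounded a → Bounded b → Bounded (a ⊕ b)
bounded-+ {a} {b} (M , p) (D , q) = M + D ,
  ev-map₂ (λ n h k → ≤-trans (∣p+q∣≤∣p∣+∣q∣ (a n) (b n)) (+-mono-≤ h k)) p q

bounded-* : ∀ {a b} → Bounded a → Bounded b → Bounded (a ⊗ b)
bounded-* {a} {b} A@(M , p) (D , q) = M * D ,
  ev-map₂ (λ n h k → ≤-trans (≤-reflexive (∣p*q∣≡∣p∣*∣q∣ (a n) (b n)))
                             (*-mono (0≤bound {a} A) (0≤∣p∣ (b n)) h k)) p q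

-- Exp K a : the sequence a has an asymptotic expansion c₀ + c₁ x + … + O(x^K) in x = 1/(n+1);
-- Exp⁺ K c a: an expansion up to O(x^(K+1)) whose constant term is c.
data Exp : ℕ → Seq → Set
record Exp⁺ (K : ℕ) (c : ℚ) (a : Seq) : Set

data Exp where
  bounded   : ∀ {a} → Bounded a → Exp zero a
  expansion : ∀ {K a} c → Exp⁺ K c a → Exp (suc K) a

record Exp⁺ K c a where
  inductive
  constructor exp⁺
  field
    remainder : Seq
    expand    : a ≈ const c ⊕ x ⊗ remainder
    exp       : Exp K remainder

exp⁺-resp-≈ : ∀ {a b} K {c} → a ≈ b → Exp⁺ K c a → Exp⁺ K c b
exp⁺-resp-≈ K a≈b (exp⁺ d a≈ D) = exp⁺ d (ev-map₂ (λ n p q → trans (sym p) q) a≈b a≈) D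

exp-resp-≈ : ∀ {a b} K → a ≈ b → Exp K a → Exp K b
exp-resp-≈ zero    a≈b (bounded (M , h)) = bounded (M , ev-map₂ (λ n p q → subst (λ z → ∣ z ∣ ≤ M) p q) a≈b h)
exp-resp-≈ (suc K) a≈b (expansion c A) = expansion c (exp⁺-resp-≈ K a≈b A)

bounded-const : ∀ c → Bounded (const c)
bounded-const c = ∣ c ∣ , always (λ _ → ≤-refl)

bounded-x : Bounded x
bounded-x = 1ℚ , always (λ n → subst (_≤ 1ℚ) (sym (∣x∣≡x n)) (x≤1 n))

exp⁺-weaken : ∀ {a} K {c} → Exp⁺ (suc K) c a → Exp⁺ K c a
exp-weaken : ∀ {a} K → Exp (suc K) a → Exp K a

exp⁺-weaken K (exp⁺ b a≈ B) = exp⁺ b a≈ (exp-weaken K B)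

exp-weaken {a} zero (expansion c (exp⁺ b a≈ (bounded B))) = exp-resp-≈ 0 (ev-map (λ _ → sym) a≈)
  (bounded (bounded-+ (bounded-const c) (bounded-* bounded-x B)))
exp-weaken {a} (suc K) (expansion c A) = expansion c (exp⁺-weaken K A)

exp-x⊗ : ∀ {a} K → Exp K a → Exp⁺ K 0ℚ (x ⊗ a)
exp-x⊗ {a} K A = exp⁺ a (always (λ n → sym (+-identityˡ (x n * a n)))) A

exp-const : ∀ K c → Exp K (const c)
exp⁺-const : ∀ K c → Exp⁺ K c (const c)

exp-const zero    c = bounded (bounded-const c)
exp-const (suc K) c = expansion c (exp⁺-const K c)

exp⁺-const K c = exp⁺ (const 0ℚ) (always (λ n → eq c (x n))) (exp-const K 0ℚ)
  where
  eq : ∀ c x → c ≡ c + x * 0ℚ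
  eq = solve-∀ ℚ-ring

exp-+ : ∀ {a b} K → Exp K a → Exp K b → Exp K (a ⊕ b)
exp⁺-+ : ∀ {a b} K {c d} → Exp⁺ K c a → Exp⁺ K d b → Exp⁺ K (c + d) (a ⊕ b)

exp-+ zero    (bounded A)     (bounded B)     = bounded (bounded-+ A B)
exp-+ (suc K) (expansion c A) (expansion d B) = expansion (c + d) (exp⁺-+ K A B)

exp⁺-+ K {c} {d} (exp⁺ e a≈ E) (exp⁺ f b≈ F) = exp⁺ (e ⊕ f)
  (ev-map₂ (λ n p q → trans (cong₂ _+_ p q) (eq c d (x n) (e n) (f n))) a≈ b≈)
  (exp-+ K E F)
  where
  eq : ∀ c d x e f → c + x * e + (d + x * f) ≡ c + d + x * (e + f)
  eq = solve-∀ ℚ-ring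

exp-* : ∀ {a b} K → Exp K a → Exp K b → Exp K (a ⊗ b)
exp⁺-* : ∀ {a b} K {c d} → Exp⁺ K c a → Exp⁺ K d b → Exp⁺ K (c * d) (a ⊗ b)

exp-* zero    (bounded A)     (bounded B)     = bounded (bounded-* A B)
exp-* (suc K) (expansion c A) (expansion d B) = expansion (c * d) (exp⁺-* K A B)

exp⁺-* K {c} {d} (exp⁺ e a≈ E) (exp⁺ f b≈ F) = exp⁺ (const c ⊗ f ⊕ const d ⊗ e ⊕ x ⊗ (e ⊗ f))
  (ev-map₂ (λ n p q → trans (cong₂ _*_ p q) (eq c d (x n) (e n) (f n))) a≈ b≈)
  (exp-+ K (exp-+ K (exp-* K (exp-const K c) F) (exp-* K (exp-const K d) E))
          (exp-weaken K (expansion 0ℚ (exp-x⊗ K (exp-* K E F)))))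
  where
  eq : ∀ c d x e f → (c + x * e) * (d + x * f) ≡ c * d + x * (c * f + d * e + x * (e * f))
  eq = solve-∀ ℚ-ring

exp-x : ∀ K → Exp⁺ K 0ℚ x
exp-x K = exp⁺ (const 1ℚ) (always (λ n → eq (x n))) (exp-const K 1ℚ)
  where
  eq : ∀ x → x ≡ 0ℚ + x * 1ℚ
  eq = solve-∀ ℚ-ring

-- Since y = 1 - x y, the remainder of y is -y itself, and each order follows from the one before.
exp-y : ∀ K → Exp K y
exp⁺-y : ∀ K → Exp⁺ K 1ℚ y

exp-y zero    = exp-resp-≈ 0 (always λ n → sym (trans (y-unfold n) (trans (eq (x n) (y n)) (cong (λ z → 1ℚ + - 1ℚ * z) (sym (x-suc n))))))
  (exp-+ 0 (exp-const 0 1ℚ) (exp-* 0 (exp-const 0 (- 1ℚ)) (bounded (1ℚ , ev-suc (bounds bounded-x)))))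
  where
  eq : ∀ x y → 1ℚ + x * (- 1ℚ * y) ≡ 1ℚ + - 1ℚ * (x * y)
  eq = solve-∀ ℚ-ring
exp-y (suc K) = expansion 1ℚ (exp⁺-y K)

exp⁺-y K = exp⁺ (const (- 1ℚ) ⊗ y) (always y-unfold) (exp-* K (exp-const K (- 1ℚ)) (exp-y K))

-- A shift replaces x by x y, so the new remainder is y times the shifted old one.
exp-suc : ∀ {a} K → Exp K a → Exp K (a ∘ suc)
exp⁺-suc : ∀ {a} K {c} → Exp⁺ K c a → Exp⁺ K c (a ∘ suc)

exp-suc zero    (bounded (M , h)) = bounded (M , ev-suc h)
exp-suc (suc K) (expansion c A)   = expansion c (exp⁺-suc K A)

exp⁺-suc {a} K {c} (exp⁺ b a≈ B) = exp⁺ (y ⊗ (b ∘ suc))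
  (ev-map (λ n p → trans p (trans (cong (λ z → c + z * b (suc n)) (x-suc n)) (cong (_+_ c) (*-assoc (x n) (y n) (b (suc n))))))
         (ev-suc a≈))
  (exp-* K (exp-y K) (exp-suc K B))

x-small : ∀ M → 0ℚ ≤ M → ∀ ε → 0ℚ < ε → Eventually (λ n → x n * M ≤ ε)
x-small M 0≤C ε 0<ε with inverse ε 0<ε
... | δ , 0<δ , εδ≡1 with archimedean (δ * M)
... | N , h = N , λ n N≤n → begin
  x n * M                        ≡⟨ *-identityˡ (x n * M) ⟨
  1ℚ * (x n * M)                 ≡⟨ cong (_* (x n * M)) εδ≡1 ⟨
  ε * δ * (x n * M)              ≡⟨ eq ε δ (x n) M ⟩
  ε * (x n * (δ * M))            ≤⟨ *-monoˡ (<⇒≤ 0<ε) (*-monoˡ (<⇒≤ (0<x n)) (≤-trans h (toℚ-mono-≤ {N} {suc n} (ℕP.m≤n⇒m≤1+n N≤n)))) ⟩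
  ε * (x n * toℚ (suc n))        ≡⟨ cong (ε *_) (n/d*d≡n (+ 1) (suc n)) ⟩
  ε * 1ℚ                         ≡⟨ *-identityʳ ε ⟩
  ε                              ∎
  where
  open ≤-Reasoning
  eq : ∀ e d x c → e * d * (x * c) ≡ e * (x * (d * c))
  eq = solve-∀ ℚ-ring

exp⁺-close : ∀ {a c} → Exp⁺ 0 c a → ∀ ε → 0ℚ < ε → Eventually (λ n → ∣ a n - c ∣ ≤ ε)
exp⁺-close {a} {c} (exp⁺ b a≈ (bounded (M , h))) ε 0<ε = ev-map₃ (λ n p q r → begin
  ∣ a n - c ∣              ≡⟨ cong (λ z → ∣ z - c ∣) p ⟩
  ∣ c + x n * b n - c ∣    ≡⟨ cong ∣_∣ (eq c (x n * b n)) ⟩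
  ∣ x n * b n ∣            ≡⟨ ∣p*q∣≡∣p∣*∣q∣ (x n) (b n) ⟩
  ∣ x n ∣ * ∣ b n ∣        ≡⟨ cong (_* ∣ b n ∣) (∣x∣≡x n) ⟩
  x n * ∣ b n ∣            ≤⟨ *-monoˡ (<⇒≤ (0<x n)) q ⟩
  x n * M                  ≤⟨ r ⟩
  ε                        ∎) a≈ h (x-small M (0≤bound (M , h)) ε 0<ε)
  where
  open ≤-Reasoning
  eq : ∀ c z → c + z - c ≡ z
  eq = solve-∀ ℚ-ring

p<q⇒0<q-p : ∀ {p q} → p < q → 0ℚ < q - p
p<q⇒0<q-p {p} {q} p<q = subst (_< q - p) (+-inverseʳ p) (+-monoˡ-< (- p) p<q)

exp⁺-≥ : ∀ {a c} d → d < c → Exp⁺ 0 c a → Eventually (λ n → d ≤ a n)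
exp⁺-≥ {a} {c} d d<c A = ev-map (λ n h → begin
  d                      ≡⟨ eq c d ⟩
  c - (c - d)            ≤⟨ +-monoʳ-≤ c (neg-antimono-≤ h) ⟩
  c - ∣ a n - c ∣        ≤⟨ +-monoʳ-≤ c (neg-antimono-≤ (-p≤∣p∣ (a n - c))) ⟩
  c - - (a n - c)        ≡⟨ eq′ c (a n) ⟩
  a n                    ∎) (exp⁺-close A (c - d) (p<q⇒0<q-p d<c))
  where
  open ≤-Reasoning
  eq : ∀ c d → d ≡ c - (c - d)
  eq = solve-∀ ℚ-ring
  eq′ : ∀ c a → c - - (a - c) ≡ a
  eq′ = solve-∀ ℚ-ring

exp⁺-0 : ∀ {a} K {c} → Exp⁺ K c a → Exp⁺ 0 c a
exp⁺-0     zero    A = A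
exp⁺-0 {a} (suc K) A = exp⁺-0 K (exp⁺-weaken K A)

exp⁺-pos : ∀ {a} K {c} → 0ℚ < c → Exp⁺ K c a → Eventually (λ n → 0ℚ < a n)
exp⁺-pos {a} K {c} 0<c A with <-dense 0<c
... | d , 0<d , d<c = ev-map (λ _ → <-≤-trans 0<d) (exp⁺-≥ d d<c (exp⁺-0 K A))

exp⁺⇒exp : ∀ {a} K {c} → Exp⁺ K c a → Exp K a
exp⁺⇒exp {a} K {c} A = exp-weaken K (expansion c A)

bounded-inverse : ∀ {a i} δ → 0ℚ < δ → Eventually (λ n → δ ≤ a n) → a ⊗ i ≈ const 1ℚ → Bounded i
bounded-inverse {a} {i} δ 0<δ δ≤a ai≡1 with inverse δ 0<δ
... | ε , 0<ε , δε≡1 = ε , ev-map₂ (λ n h eq → *-cancelˡ 0<δ (begin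
  δ * ∣ i n ∣          ≤⟨ *-monoʳ (0≤∣p∣ (i n)) (≤-trans h (p≤∣p∣ (a n))) ⟩
  ∣ a n ∣ * ∣ i n ∣    ≡⟨ ∣p*q∣≡∣p∣*∣q∣ (a n) (i n) ⟨
  ∣ a n * i n ∣        ≡⟨ cong ∣_∣ eq ⟩
  1ℚ                   ≡⟨ δε≡1 ⟨
  δ * ε                ∎)) δ≤a ai≡1
  where open ≤-Reasoning

-- 1/(c + x b) = 1/c - x · (b/c) · 1/(c + x b), so each order of a⁻¹ comes from the previous one.
exp-inverse-step : ∀ {a i} K {c c′} → c * c′ ≡ 1ℚ → a ⊗ i ≈ const 1ℚ →
                   Exp⁺ K c a → Exp K i → Exp⁺ K c′ i
exp-inverse-step {a} {i} K {c} {c′} cc′≡1 ai≡1 (exp⁺ b a≈ B) I = exp⁺ (const (- c′) ⊗ (b ⊗ i))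
  (ev-map₂ (λ n p q → begin
    i n                                               ≡⟨ eq₁ (i n) ⟩
    i n * 1ℚ                                          ≡⟨ cong (i n *_) cc′≡1 ⟨
    i n * (c * c′)                                    ≡⟨ eq₂ (i n) c c′ (x n) (b n) ⟩
    c′ * ((c + x n * b n) * i n) + x n * (- c′ * (b n * i n))  ≡⟨ cong (λ z → c′ * (z * i n) + x n * (- c′ * (b n * i n))) p ⟨
    c′ * (a n * i n) + x n * (- c′ * (b n * i n))     ≡⟨ cong (λ z → c′ * z + x n * (- c′ * (b n * i n))) q ⟩
    c′ * 1ℚ + x n * (- c′ * (b n * i n))              ≡⟨ cong (_+ x n * (- c′ * (b n * i n))) (*-identityʳ c′) ⟩
    c′ + x n * (- c′ * (b n * i n))                   ∎) a≈ ai≡1)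
  (exp-* K (exp-const K (- c′)) (exp-* K B I))
  where
  open ≡-Reasoning
  eq₁ : ∀ i → i ≡ i * 1ℚ
  eq₁ = solve-∀ ℚ-ring
  eq₂ : ∀ i c d x b → i * (c * d) ≡ d * ((c + x * b) * i) + x * (- d * (b * i))
  eq₂ = solve-∀ ℚ-ring

-- The remainder of the reciprocal contains the reciprocal itself, so the induction starts from its
-- boundedness: eventually a ≥ δ for a rational δ strictly between 0 and c.
exp⁺-inverse : ∀ {a i} K {c c′} → 0ℚ < c → c * c′ ≡ 1ℚ → a ⊗ i ≈ const 1ℚ →
               Exp⁺ K c a → Exp⁺ K c′ i
exp⁺-inverse {a} {i} zero 0<c cc′≡1 ai≡1 A with <-dense 0<c
... | δ , 0<δ , δ<c = exp-inverse-step 0 cc′≡1 ai≡1 A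
                        (bounded (bounded-inverse δ 0<δ (exp⁺-≥ δ δ<c A) ai≡1))
exp⁺-inverse {a} {i} (suc K) {c} {c′} 0<c cc′≡1 ai≡1 A =
  exp-inverse-step (suc K) cc′≡1 ai≡1 A
    (expansion c′ (exp⁺-inverse K 0<c cc′≡1 ai≡1 (exp⁺-weaken K A)))

-- Contracting recurrences

exp⁺-head : ∀ {K c d a} → c ≡ d → Exp⁺ K c a → Exp⁺ K d a
exp⁺-head refl A = A

exp-bounded : ∀ {a} → Exp 0 a → Bounded a
exp-bounded (bounded A) = A

contraction-bounded : ∀ {u v d : Seq} θ → θ < 1ℚ → Eventually (λ n → ∣ v n ∣ ≤ θ) →
                      Bounded u → d ∘ suc ≈ u ⊕ v ⊗ d → Bounded d
contraction-bounded {u} {v} {d} θ θ<1 v≤θ (U , u≤U) rec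
  with inverse (1ℚ - θ) (p<q⇒0<q-p θ<1) | ev-map₃ (λ _ p q r → p , (q , r)) v≤θ u≤U rec
... | ε , 0<ε , ε-inv | N , h = M , (N , λ n N≤n → subst (λ m → ∣ d m ∣ ≤ M) (ℕP.m∸n+n≡m N≤n) (d≤M (n ℕ.∸ N)))
  where
  -- Here ε = 1/(1-θ). Every M ≥ U/(1-θ) satisfies U + θM ≤ M, and the summand ∣ d N ∣ covers the
  -- starting index.
  M = ∣ d N ∣ + U * ε
  0≤θ : 0ℚ ≤ θ
  0≤θ = ≤-trans (0≤∣p∣ (v N)) (proj₁ (h N ℕP.≤-refl))
  0≤U : 0ℚ ≤ U
  0≤U = ≤-trans (0≤∣p∣ (u N)) (proj₁ (proj₂ (h N ℕP.≤-refl)))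
  stable : U + θ * M ≤ M
  stable = 0≤q-p⇒p≤q (subst (0ℚ ≤_) (begin
      (1ℚ - θ) * ∣ d N ∣                               ≡⟨ eq₁ ((1ℚ - θ) * ∣ d N ∣) U ⟩
      (1ℚ - θ) * ∣ d N ∣ + U * 1ℚ - U                  ≡⟨ cong (λ z → (1ℚ - θ) * ∣ d N ∣ + U * z - U) ε-inv ⟨
      (1ℚ - θ) * ∣ d N ∣ + U * ((1ℚ - θ) * ε) - U      ≡⟨ eq₂ θ ∣ d N ∣ U ε ⟩
      M - (U + θ * M) ∎)
    (*-nonNeg (<⇒≤ (p<q⇒0<q-p θ<1)) (0≤∣p∣ (d N))))
    where
    open ≡-Reasoning
    eq₁ : ∀ a u → a ≡ a + u * 1ℚ - u
    eq₁ = solve-∀ ℚ-ring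
    eq₂ : ∀ t a u e → (1ℚ - t) * a + u * ((1ℚ - t) * e) - u ≡ a + u * e - (u + t * (a + u * e))
    eq₂ = solve-∀ ℚ-ring
  d≤M : ∀ m → ∣ d (m ℕ.+ N) ∣ ≤ M
  d≤M zero = subst (_≤ M) (+-identityʳ ∣ d N ∣) (+-monoʳ-≤ ∣ d N ∣ (*-nonNeg 0≤U (<⇒≤ 0<ε)))
  d≤M (suc m) with h (m ℕ.+ N) (ℕP.m≤n+m N m)
  ... | v≤ , u≤ , eq = begin
    ∣ d (suc k) ∣                     ≡⟨ cong ∣_∣ eq ⟩
    ∣ u k + v k * d k ∣               ≤⟨ ∣p+q∣≤∣p∣+∣q∣ (u k) (v k * d k) ⟩
    ∣ u k ∣ + ∣ v k * d k ∣           ≡⟨ cong (_+_ ∣ u k ∣) (∣p*q∣≡∣p∣*∣q∣ (v k) (d k)) ⟩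
    ∣ u k ∣ + ∣ v k ∣ * ∣ d k ∣       ≤⟨ +-mono-≤ u≤ (*-mono 0≤θ (0≤∣p∣ (d k)) v≤ (d≤M m)) ⟩
    U + θ * M                         ≤⟨ stable ⟩
    M                                 ∎
    where
    open ≤-Reasoning
    k = m ℕ.+ N

n+2·x : ∀ n → toℚ (suc (suc n)) * x n ≡ 1ℚ + x n
n+2·x n = begin
  toℚ (suc (suc n)) * x n         ≡⟨ cong (_* x n) (toℚ-suc (suc n)) ⟩
  (toℚ (suc n) + 1ℚ) * x n        ≡⟨ eq (toℚ (suc n)) (x n) ⟩
  toℚ (suc n) * x n + x n         ≡⟨ cong (_+ x n) (n+1·x n) ⟩
  1ℚ + x n                        ∎
  where
  open ≡-Reasoning
  eq : ∀ a x → (a + 1ℚ) * x ≡ a * x + x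
  eq = solve-∀ ℚ-ring

-- The rescaled deviation (n+1)(d - c) from the fixed point c = u₀ + v₀ c satisfies a recurrence of
-- the same shape, which yields the expansion of d one order at a time.
contraction-exp : ∀ K {u v d : Seq} {c u₀ v₀} w θ → θ < 1ℚ → Eventually (λ n → ∣ v n ∣ ≤ θ) →
                  (1ℚ - v₀) * w ≡ 1ℚ → c ≡ u₀ + v₀ * c → Exp⁺ K u₀ u → Exp⁺ K v₀ v →
                  d ∘ suc ≈ u ⊕ v ⊗ d → Exp⁺ K c d
contraction-exp K {u} {v} {d} {c} {u₀} {v₀} w θ θ<1 v≤θ w-inv fix (exp⁺ u₁ u≈ U₁) V@(exp⁺ v₁ v≈ V₁) rec =
  exp⁺ e (always λ n → sym (unscale n)) (conclude K (u′-exp K U₁ V₁) V)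
  where
  e u′ v′ : Seq
  e n = toℚ (suc n) * (d n - c)
  -- 1 + x = (n+2)/(n+1) is the quotient of the scaling factors at n+1 and n.
  u′ = (const 1ℚ ⊕ x) ⊗ (u₁ ⊕ const c ⊗ v₁)
  v′ = (const 1ℚ ⊕ x) ⊗ v
  unscale : ∀ n → c + x n * e n ≡ d n
  unscale n = trans (eq c (x n) (toℚ (suc n)) (d n)) (trans (cong (λ z → c + z * (d n - c)) (n+1·x n)) (eq′ c (d n)))
    where
    eq : ∀ c x t d → c + x * (t * (d - c)) ≡ c + (t * x) * (d - c)
    eq = solve-∀ ℚ-ring
    eq′ : ∀ c d → c + 1ℚ * (d - c) ≡ d
    eq′ = solve-∀ ℚ-ring
  rec′ : e ∘ suc ≈ u′ ⊕ v′ ⊗ e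
  rec′ = ev-map₃ (λ n r p q → begin
    toℚ (suc (suc n)) * (d (suc n) - c)
      ≡⟨ cong (λ z → toℚ (suc (suc n)) * (z - c)) (trans r (cong₂ _+_ p (cong (v n *_) (sym (unscale n))))) ⟩
    toℚ (suc (suc n)) * (u₀ + x n * u₁ n + v n * (c + x n * e n) - c)
      ≡⟨ cong (λ z → toℚ (suc (suc n)) * (z - c)) (eq₁ u₀ (x n) (u₁ n) (v n) c (e n)) ⟩
    toℚ (suc (suc n)) * (u₀ + v n * c + x n * (u₁ n + v n * e n) - c)
      ≡⟨ cong (λ z → toℚ (suc (suc n)) * (u₀ + z * c + x n * (u₁ n + v n * e n) - c)) q ⟩
    toℚ (suc (suc n)) * (u₀ + (v₀ + x n * v₁ n) * c + x n * (u₁ n + v n * e n) - c)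
      ≡⟨ cong (λ z → toℚ (suc (suc n)) * (z - c)) (eq₂ u₀ v₀ (x n) (v₁ n) c (u₁ n + v n * e n)) ⟩
    toℚ (suc (suc n)) * ((u₀ + v₀ * c) + x n * (v₁ n * c + (u₁ n + v n * e n)) - c)
      ≡⟨ cong (λ z → toℚ (suc (suc n)) * (z + x n * (v₁ n * c + (u₁ n + v n * e n)) - c)) fix ⟨
    toℚ (suc (suc n)) * (c + x n * (v₁ n * c + (u₁ n + v n * e n)) - c)
      ≡⟨ eq₃ (toℚ (suc (suc n))) c (x n) (v₁ n) (u₁ n) (v n * e n) ⟩
    (toℚ (suc (suc n)) * x n) * (u₁ n + c * v₁ n + v n * e n)
      ≡⟨ cong (_* (u₁ n + c * v₁ n + v n * e n)) (n+2·x n) ⟩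
    (1ℚ + x n) * (u₁ n + c * v₁ n + v n * e n)
      ≡⟨ eq₄ (1ℚ + x n) (u₁ n + c * v₁ n) (v n) (e n) ⟩
    (1ℚ + x n) * (u₁ n + c * v₁ n) + (1ℚ + x n) * v n * e n ∎) rec u≈ v≈
    where
    open ≡-Reasoning
    eq₁ : ∀ u x u₁ v c e → u + x * u₁ + v * (c + x * e) ≡ u + v * c + x * (u₁ + v * e)
    eq₁ = solve-∀ ℚ-ring
    eq₂ : ∀ u v x v₁ c r → u + (v + x * v₁) * c + x * r ≡ (u + v * c) + x * (v₁ * c + r)
    eq₂ = solve-∀ ℚ-ring
    eq₃ : ∀ t c x v u r → t * (c + x * (v * c + (u + r)) - c) ≡ (t * x) * (u + c * v + r)
    eq₃ = solve-∀ ℚ-ring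
    eq₄ : ∀ a r v e → a * (r + v * e) ≡ a * r + a * v * e
    eq₄ = solve-∀ ℚ-ring
  -- The factor 1 + x may push ∣ v′ ∣ above θ, so the contraction constant is enlarged a little,
  -- still below 1.
  θ′ : ℚ
  θ′ = proj₁ (<-dense θ<1)
  θ<θ′ : θ < θ′
  θ<θ′ = proj₁ (proj₂ (<-dense θ<1))
  θ′<1 : θ′ < 1ℚ
  θ′<1 = proj₂ (proj₂ (<-dense θ<1))
  0≤1+x : ∀ n → 0ℚ ≤ 1ℚ + x n
  0≤1+x n = +-nonNeg {1ℚ} {x n} (<⇒≤ 0<1ℚ) (<⇒≤ (0<x n))
  v′≤θ′ : Eventually (λ n → ∣ v′ n ∣ ≤ θ′)
  v′≤θ′ = ev-map₂ (λ n p q → begin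
      ∣ (1ℚ + x n) * v n ∣      ≡⟨ ∣p*q∣≡∣p∣*∣q∣ (1ℚ + x n) (v n) ⟩
      ∣ 1ℚ + x n ∣ * ∣ v n ∣    ≡⟨ cong (_* ∣ v n ∣) (0≤p⇒∣p∣≡p (0≤1+x n)) ⟩
      (1ℚ + x n) * ∣ v n ∣      ≤⟨ *-monoˡ (0≤1+x n) p ⟩
      (1ℚ + x n) * θ            ≡⟨ eq (x n) θ ⟩
      θ + x n * θ               ≤⟨ +-monoʳ-≤ θ q ⟩
      θ + (θ′ - θ)              ≡⟨ eq′ θ θ′ ⟩
      θ′                        ∎)
    v≤θ (x-small θ (0≤θ v≤θ) (θ′ - θ) (p<q⇒0<q-p θ<θ′))
    where
    open ≤-Reasoning
    0≤θ : Eventually (λ n → ∣ v n ∣ ≤ θ) → 0ℚ ≤ θ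
    0≤θ (N , h) = ≤-trans (0≤∣p∣ (v N)) (h N ℕP.≤-refl)
    eq : ∀ x t → (1ℚ + x) * t ≡ t + x * t
    eq = solve-∀ ℚ-ring
    eq′ : ∀ s t → s + (t - s) ≡ t
    eq′ = solve-∀ ℚ-ring
  u′-exp : ∀ K → Exp K u₁ → Exp K v₁ → Exp K u′
  u′-exp K U₁ V₁ = exp-* K (exp-+ K (exp-const K 1ℚ) (exp⁺⇒exp K (exp-x K))) (exp-+ K U₁ (exp-* K (exp-const K c) V₁))
  conclude : ∀ K → Exp K u′ → Exp⁺ K v₀ v → Exp K e
  conclude zero (bounded U′) _ = bounded (contraction-bounded {u′} {v′} {e} θ′ θ′<1 v′≤θ′ U′ rec′)
  -- Multiplication by 1 + x does not change the limit v₀, so w = 1/(1-v₀) serves again and the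
  -- rescaled recurrence has the fixed point u₀′ w.
  conclude (suc K) (expansion u₀′ U′) V = expansion (u₀′ * w)
    (contraction-exp K {u′} {v′} {e} {u₀′ * w} {u₀′} {v₀} w θ′ θ′<1 v′≤θ′ w-inv fix′ U′
      (exp⁺-head head (exp⁺-* K (exp⁺-+ K (exp⁺-const K 1ℚ) (exp-x K)) (exp⁺-weaken K V))) rec′)
    where
    open ≡-Reasoning
    head : (1ℚ + 0ℚ) * v₀ ≡ v₀
    head = eq v₀
      where
      eq : ∀ v → (1ℚ + 0ℚ) * v ≡ v
      eq = solve-∀ ℚ-ring
    fix′ : u₀′ * w ≡ u₀′ + v₀ * (u₀′ * w)
    fix′ = begin
      u₀′ * w                                      ≡⟨ eq u₀′ v₀ w ⟩
      u₀′ * ((1ℚ - v₀) * w) + v₀ * (u₀′ * w)       ≡⟨ cong (λ z → u₀′ * z + v₀ * (u₀′ * w)) w-inv ⟩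
      u₀′ * 1ℚ + v₀ * (u₀′ * w)                    ≡⟨ cong (_+ v₀ * (u₀′ * w)) (*-identityʳ u₀′) ⟩
      u₀′ + v₀ * (u₀′ * w)                         ∎
      where
      eq : ∀ u v w → u * w ≡ u * ((1ℚ - v) * w) + v * (u * w)
      eq = solve-∀ ℚ-ring

-- The recurrence for ρ is nonlinear. It becomes linear in the deviation (n+1)(ρ - 8) when ρ⁻¹ is
-- treated as a coefficient: 7 + 8ρ⁻¹ - 8 = (8 - ρ)ρ⁻¹ is -x · `deviation` · ρ⁻¹.
module Riccati (ρ ρ⁻¹ p₁ q₁ : Seq)
  (ρρ⁻¹≡1 : ∀ n → ρ n * ρ⁻¹ n ≡ 1ℚ) (0<ρ⁻¹ : ∀ n → 0ℚ < ρ⁻¹ n)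
  (riccati : ∀ n → ρ (suc n) ≡ (toℚ 7 + x n * p₁ n) + (toℚ 8 + x n * q₁ n) * ρ⁻¹ n)
  (p₁-exp : ∀ K → Exp⁺ K (- toℚ 28) p₁) (q₁-exp : ∀ K → Exp⁺ K (- toℚ 64) q₁) where

  deviation u v : Seq
  deviation n = toℚ (suc n) * (ρ n - toℚ 8)
  u = (const 1ℚ ⊕ x) ⊗ (p₁ ⊕ q₁ ⊗ ρ⁻¹)
  v = const (- 1ℚ) ⊗ ((const 1ℚ ⊕ x) ⊗ ρ⁻¹)

  ρ-deviation : ∀ n → ρ n ≡ toℚ 8 + x n * deviation n
  ρ-deviation n = sym (trans (eq (x n) (toℚ (suc n)) (ρ n)) (trans (cong (λ z → toℚ 8 + z * (ρ n - toℚ 8)) (n+1·x n)) (eq′ (ρ n))))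
    where
    eq : ∀ x t r → toℚ 8 + x * (t * (r - toℚ 8)) ≡ toℚ 8 + (t * x) * (r - toℚ 8)
    eq = solve-∀ ℚ-ring
    eq′ : ∀ r → toℚ 8 + 1ℚ * (r - toℚ 8) ≡ r
    eq′ = solve-∀ ℚ-ring

  deviation-rec : deviation ∘ suc ≈ u ⊕ v ⊗ deviation
  deviation-rec = always λ n → begin
    toℚ (suc (suc n)) * (ρ (suc n) - toℚ 8)
      ≡⟨ cong (λ z → toℚ (suc (suc n)) * (z - toℚ 8)) (riccati n) ⟩
    toℚ (suc (suc n)) * ((toℚ 7 + x n * p₁ n) + (toℚ 8 + x n * q₁ n) * ρ⁻¹ n - toℚ 8)
      ≡⟨ eq₁ (toℚ (suc (suc n))) (x n) (p₁ n) (q₁ n) (ρ⁻¹ n) ⟩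
    toℚ (suc (suc n)) * (x n * (p₁ n + q₁ n * ρ⁻¹ n) + toℚ 8 * ρ⁻¹ n - 1ℚ)
      ≡⟨ cong (λ z → toℚ (suc (suc n)) * (x n * (p₁ n + q₁ n * ρ⁻¹ n) + toℚ 8 * ρ⁻¹ n - z)) (ρρ⁻¹≡1 n) ⟨
    toℚ (suc (suc n)) * (x n * (p₁ n + q₁ n * ρ⁻¹ n) + toℚ 8 * ρ⁻¹ n - ρ n * ρ⁻¹ n)
      ≡⟨ cong (λ z → toℚ (suc (suc n)) * (x n * (p₁ n + q₁ n * ρ⁻¹ n) + toℚ 8 * ρ⁻¹ n - z * ρ⁻¹ n)) (ρ-deviation n) ⟩
    toℚ (suc (suc n)) * (x n * (p₁ n + q₁ n * ρ⁻¹ n) + toℚ 8 * ρ⁻¹ n - (toℚ 8 + x n * deviation n) * ρ⁻¹ n)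
      ≡⟨ eq₂ (toℚ (suc (suc n))) (x n) (p₁ n + q₁ n * ρ⁻¹ n) (ρ⁻¹ n) (deviation n) ⟩
    toℚ (suc (suc n)) * x n * (p₁ n + q₁ n * ρ⁻¹ n - ρ⁻¹ n * deviation n)
      ≡⟨ cong (_* (p₁ n + q₁ n * ρ⁻¹ n - ρ⁻¹ n * deviation n)) (n+2·x n) ⟩
    (1ℚ + x n) * (p₁ n + q₁ n * ρ⁻¹ n - ρ⁻¹ n * deviation n)
      ≡⟨ eq₃ (x n) (p₁ n + q₁ n * ρ⁻¹ n) (ρ⁻¹ n) (deviation n) ⟩
    u n + v n * deviation n ∎
    where
    open ≡-Reasoning
    eq₁ : ∀ t x p q ρ⁻¹ → t * ((toℚ 7 + x * p) + (toℚ 8 + x * q) * ρ⁻¹ - toℚ 8) ≡ t * (x * (p + q * ρ⁻¹) + toℚ 8 * ρ⁻¹ - 1ℚ)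
    eq₁ = solve-∀ ℚ-ring
    eq₂ : ∀ t x r ρ⁻¹ d → t * (x * r + toℚ 8 * ρ⁻¹ - (toℚ 8 + x * d) * ρ⁻¹) ≡ t * x * (r - ρ⁻¹ * d)
    eq₂ = solve-∀ ℚ-ring
    eq₃ : ∀ x r ρ⁻¹ d → (1ℚ + x) * (r - ρ⁻¹ * d) ≡ (1ℚ + x) * r + - 1ℚ * ((1ℚ + x) * ρ⁻¹) * d
    eq₃ = solve-∀ ℚ-ring

  -- A contraction constant is required before the limit of ρ is known. The term with ρ⁻¹ is
  -- eventually nonnegative and the other tends to 7, so any constant below 7 is an eventual lower
  -- bound. With 6, ∣ v ∣ = (1 + x)ρ⁻¹ ≤ 2/6 < ½.
  6≤ρ : Eventually (λ n → toℚ 6 ≤ ρ (suc n))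
  6≤ρ = ev-map₂ (λ n p q → begin
    toℚ 6                                                       ≡⟨ +-identityʳ (toℚ 6) ⟨
    toℚ 6 + 0ℚ                                                  ≤⟨ +-mono-≤ p (*-nonNeg (<⇒≤ q) (<⇒≤ (0<ρ⁻¹ n))) ⟩
    (toℚ 7 + x n * p₁ n) + (toℚ 8 + x n * q₁ n) * ρ⁻¹ n           ≡⟨ riccati n ⟨
    ρ (suc n)                                                   ∎)
    (exp⁺-≥ {const (toℚ 7) ⊕ x ⊗ p₁} {toℚ 7} (toℚ 6) (toWitness {a? = toℚ 6 <? toℚ 7} _) (exp⁺ p₁ (always λ n → refl) (exp⁺⇒exp 0 (p₁-exp 0))))
    (exp⁺-pos {const (toℚ 8) ⊕ x ⊗ q₁} 0 {toℚ 8} (toWitness {a? = 0ℚ <? toℚ 8} _) (exp⁺ q₁ (always λ n → refl) (exp⁺⇒exp 0 (q₁-exp 0))))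
    where open ≤-Reasoning

  6ρ⁻¹≤1 : Eventually (λ n → toℚ 6 * ρ⁻¹ n ≤ 1ℚ)
  6ρ⁻¹≤1 = unshift 6≤ρ
    where
    unshift : Eventually (λ n → toℚ 6 ≤ ρ (suc n)) → Eventually (λ n → toℚ 6 * ρ⁻¹ n ≤ 1ℚ)
    unshift (N , h) = suc N , λ { (suc n) (ℕ.s≤s N≤n) → subst (toℚ 6 * ρ⁻¹ (suc n) ≤_) (ρρ⁻¹≡1 (suc n)) (*-monoʳ {ρ⁻¹ (suc n)} {toℚ 6} {ρ (suc n)} (<⇒≤ (0<ρ⁻¹ (suc n))) (h n N≤n)) }

  ρ⁻¹-bounded : Bounded ρ⁻¹
  ρ⁻¹-bounded = + 1 / 6 , ev-map (λ n h → ∣p∣≤ {ρ⁻¹ n} {+ 1 / 6} (*-cancelˡ {toℚ 6} {ρ⁻¹ n} {+ 1 / 6} (toWitness {a? = 0ℚ <? toℚ 6} _) h)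
    (≤-trans (neg-antimono-≤ (<⇒≤ (0<ρ⁻¹ n))) (toWitness {a? = 0ℚ ≤? + 1 / 6} _))) 6ρ⁻¹≤1

  v≤½ : Eventually (λ n → ∣ v n ∣ ≤ ½)
  v≤½ = ev-map (λ n h → *-cancelˡ {toℚ 6} {∣ v n ∣} {½} (toWitness {a? = 0ℚ <? toℚ 6} _) (begin
    toℚ 6 * ∣ - 1ℚ * ((1ℚ + x n) * ρ⁻¹ n) ∣     ≡⟨ cong (toℚ 6 *_) (trans (∣p*q∣≡∣p∣*∣q∣ (- 1ℚ) ((1ℚ + x n) * ρ⁻¹ n)) (cong (1ℚ *_) (0≤p⇒∣p∣≡p (*-nonNeg {1ℚ + x n} {ρ⁻¹ n} (0≤1+x n) (<⇒≤ (0<ρ⁻¹ n)))))) ⟩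
    toℚ 6 * (1ℚ * ((1ℚ + x n) * ρ⁻¹ n))         ≡⟨ eq (x n) (ρ⁻¹ n) ⟩
    (1ℚ + x n) * (toℚ 6 * ρ⁻¹ n)                ≤⟨ *-mono {1ℚ + x n} {toℚ 2} {toℚ 6 * ρ⁻¹ n} {1ℚ} (toWitness {a? = 0ℚ ≤? toℚ 2} _) (*-nonNeg {toℚ 6} {ρ⁻¹ n} (0≤toℚ 6) (<⇒≤ (0<ρ⁻¹ n))) (+-monoʳ-≤ 1ℚ (x≤1 n)) h ⟩
    toℚ 2                                     ≤⟨ toWitness {a? = toℚ 2 ≤? toℚ 6 * ½} _ ⟩
    toℚ 6 * ½                                 ∎)) 6ρ⁻¹≤1
    where
    open ≤-Reasoning
    0≤1+x : ∀ n → 0ℚ ≤ 1ℚ + x n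
    0≤1+x n = +-nonNeg {1ℚ} {x n} (<⇒≤ 0<1ℚ) (<⇒≤ (0<x n))
    eq : ∀ x ρ⁻¹ → toℚ 6 * (1ℚ * ((1ℚ + x) * ρ⁻¹)) ≡ (1ℚ + x) * (toℚ 6 * ρ⁻¹)
    eq = solve-∀ ℚ-ring

  1+x-exp : ∀ K → Exp⁺ K 1ℚ (const 1ℚ ⊕ x)
  1+x-exp K = exp⁺-+ K (exp⁺-const K 1ℚ) (exp-x K)

  ρ-exp′ : ∀ K → Exp K deviation → Exp⁺ K (toℚ 8) ρ
  ρ-exp′ K D = exp⁺ deviation (always ρ-deviation) D

  ρ⁻¹-exp′ : ∀ K → Exp K deviation → Exp⁺ K (+ 1 / 8) ρ⁻¹
  ρ⁻¹-exp′ K D = exp⁺-inverse {ρ} {ρ⁻¹} K {toℚ 8} {+ 1 / 8} (toWitness {a? = 0ℚ <? toℚ 8} _) refl (always ρρ⁻¹≡1) (ρ-exp′ K D)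

  -- A bootstrap: an expansion of the deviation gives one of ρ⁻¹, hence of the coefficients u and v,
  -- and the contraction returns the deviation one order further. The limits are u₀ = -28 - 64/8 =
  -- -36 and v₀ = -1/8, whence 1/(1-v₀) = 8/9 and the fixed point -36 · 8/9 = -32.
  deviation-exp′ : ∀ K → Exp K deviation → Exp⁺ K (- toℚ 32) deviation
  deviation-exp′ K D = contraction-exp K {u} {v} {deviation} { - toℚ 32} {u₀} {v₀} (+ 8 / 9) ½ (toWitness {a? = ½ <? 1ℚ} _) v≤½ refl refl
    (exp⁺-* K (1+x-exp K) (exp⁺-+ K (p₁-exp K) (exp⁺-* K (q₁-exp K) I)))
    (exp⁺-* K (exp⁺-const K (- 1ℚ)) (exp⁺-* K (1+x-exp K) I))
    deviation-rec
    where
    I = ρ⁻¹-exp′ K D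
    u₀ v₀ : ℚ
    u₀ = (1ℚ + 0ℚ) * (- toℚ 28 + - toℚ 64 * (+ 1 / 8))
    v₀ = - 1ℚ * ((1ℚ + 0ℚ) * (+ 1 / 8))

  deviation-exp : ∀ K → Exp K deviation
  deviation-exp zero = bounded (contraction-bounded {u} {v} {deviation} ½ (toWitness {a? = ½ <? 1ℚ} _) v≤½ u-bounded deviation-rec)
    where
    u-bounded : Bounded u
    u-bounded = exp-bounded (exp-* 0 (exp⁺⇒exp 0 (1+x-exp 0)) (exp-+ 0 (exp⁺⇒exp 0 (p₁-exp 0)) (exp-* 0 (exp⁺⇒exp 0 (q₁-exp 0)) (bounded ρ⁻¹-bounded))))
  deviation-exp (suc K) = expansion (- toℚ 32) (deviation-exp′ K (deviation-exp K))

  deviation-exp⁺ : ∀ K → Exp⁺ K (- toℚ 32) deviation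
  deviation-exp⁺ K = deviation-exp′ K (deviation-exp K)

  ρ⁻¹-exp : ∀ K → Exp⁺ K (+ 1 / 8) ρ⁻¹
  ρ⁻¹-exp K = ρ⁻¹-exp′ K (deviation-exp K)

-- Asymptotic log-convexity

-- A total reciprocal, with default 0 off the positive numbers, so that sequences known to be
-- positive only eventually can be inverted termwise.
inv : ℚ → ℚ
inv p with 0ℚ <? p
... | yes 0<p = proj₁ (inverse p 0<p)
... | no  _   = 0ℚ

p*inv[p] : ∀ p → 0ℚ < p → p * inv p ≡ 1ℚ
p*inv[p] p 0<p with 0ℚ <? p
... | yes 0<p′ = proj₂ (proj₂ (inverse p 0<p′))
... | no  0≮p  = ⊥-elim (0≮p 0<p)

inv-pos : ∀ p → 0ℚ < p → 0ℚ < inv p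
inv-pos p 0<p with 0ℚ <? p
... | yes 0<p′ = proj₁ (proj₂ (inverse p 0<p′))
... | no  0≮p  = ⊥-elim (0≮p 0<p)

-- The invariant carried through the iterates of `𝓛`. The order K is quantified inside it because
-- order K for `𝓛 a` consumes order K + 2 for a.
record AsympLogConvexWitness (a : Seq) : Set where
  field
    ev-pos    : Eventually (λ n → 0ℚ < a n)
    ratio     : Seq
    𝓛-ratio   : Eventually (λ n → 𝓛 a n ≡ x n * x n * ratio n * (a (suc n) * a (suc n)))
    ratio-exp : ∀ K → Σ[ c ∈ ℚ ] 0ℚ < c × Exp⁺ K c ratio

open AsympLogConvexWitness

-- Relative second differences

infixl 6 _⊞_
-- Multiplication of factors 1 + x²a, written in the coordinate a. Constant terms add because the
-- cross term carries x².
_⊞_ : Seq → Seq → Seq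
a ⊞ b = a ⊕ b ⊕ x ⊗ (x ⊗ (a ⊗ b))

1+x²⊞ : ∀ a b n → 1ℚ + x n * x n * (a ⊞ b) n ≡ (1ℚ + x n * x n * a n) * (1ℚ + x n * x n * b n)
1+x²⊞ a b n = eq (x n) (a n) (b n)
  where
  eq : ∀ x a b → 1ℚ + x * x * (a + b + x * (x * (a * b))) ≡ (1ℚ + x * x * a) * (1ℚ + x * x * b)
  eq = solve-∀ ℚ-ring

exp⁺-⊞ : ∀ {a b c d} K → Exp⁺ K c a → Exp⁺ K d b → Exp⁺ K (c + d) (a ⊞ b)
exp⁺-⊞ {c = c} {d} K A B = exp⁺-head (eq c d)
  (exp⁺-+ K (exp⁺-+ K A B) (exp⁺-* K (exp-x K) (exp⁺-* K (exp-x K) (exp⁺-* K A B))))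
  where
  eq : ∀ c d → c + d + 0ℚ * (0ℚ * (c * d)) ≡ c + d
  eq = solve-∀ ℚ-ring

y₂ : Seq
y₂ = y ⊗ (y ∘ suc)

exp⁺-y₂ : ∀ K → Exp⁺ K 1ℚ y₂
exp⁺-y₂ K = exp⁺-* K (exp⁺-y K) (exp⁺-suc K (exp⁺-y K))

x-suc² : ∀ n → x (suc (suc n)) ≡ x n * y₂ n
x-suc² n = trans (x-suc (suc n)) (trans (cong (_* y (suc n)) (x-suc n)) (*-assoc (x n) (y n) (y (suc n))))

y-suc : ∀ n → y (suc n) ≡ 1ℚ - x n * y₂ n
y-suc n = trans (y-unfold (suc n)) (trans (cong (λ z → 1ℚ + z * (- 1ℚ * y (suc n))) (x-suc n)) (eq (x n) (y n) (y (suc n))))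
  where
  eq : ∀ x y y′ → 1ℚ + x * y * (- 1ℚ * y′) ≡ 1ℚ - x * (y * y′)
  eq = solve-∀ ℚ-ring

1-y : ∀ n → 1ℚ - y n ≡ x n * y n
1-y n = trans (cong (_-_ 1ℚ) (y-unfold n)) (eq (x n) (y n))
  where
  eq : ∀ x y → 1ℚ - (1ℚ + x * (- 1ℚ * y)) ≡ x * y
  eq = solve-∀ ℚ-ring

y-y₂ : ∀ n → y n - y₂ n ≡ x n * (y n * y₂ n)
y-y₂ n = trans (cong (λ z → y n - y n * z) (y-suc n)) (eq (x n) (y n) (y₂ n))
  where
  eq : ∀ x y g → y - y * (1ℚ - x * g) ≡ x * (y * g)
  eq = solve-∀ ℚ-ring

-- Times x, the left side is the second difference of 1/(n+1), which is O(x³).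
y-second-difference : ∀ n → 1ℚ - toℚ 2 * y n + y₂ n ≡ x n * x n * (y n * y n * (1ℚ + y₂ n))
y-second-difference n = begin
  1ℚ - toℚ 2 * y n + y₂ n                                ≡⟨ eq₁ (y n) (y₂ n) ⟩
  (1ℚ - y n) - (y n - y₂ n)                              ≡⟨ cong₂ _-_ (1-y n) (y-y₂ n) ⟩
  x n * y n - x n * (y n * y₂ n)                         ≡⟨ eq₂ (x n) (y n) (y₂ n) ⟩
  x n * y n * ((1ℚ - y n) + (y n - y₂ n))                ≡⟨ cong (x n * y n *_) (cong₂ _+_ (1-y n) (y-y₂ n)) ⟩
  x n * y n * (x n * y n + x n * (y n * y₂ n))           ≡⟨ eq₃ (x n) (y n) (y₂ n) ⟩
  x n * x n * (y n * y n * (1ℚ + y₂ n))                  ∎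
  where
  open ≡-Reasoning
  eq₁ : ∀ y g → 1ℚ - toℚ 2 * y + g ≡ (1ℚ - y) - (y - g)
  eq₁ = solve-∀ ℚ-ring
  eq₂ : ∀ x y g → x * y - x * (y * g) ≡ x * y * ((1ℚ - y) + (y - g))
  eq₂ = solve-∀ ℚ-ring
  eq₃ : ∀ x y g → x * y * (x * y + x * (y * g)) ≡ x * x * (y * y * (1ℚ + g))
  eq₃ = solve-∀ ℚ-ring

-- This is (n+2)² = (n+1)(n+3) + 1, which shows that x(n) x(n+2) / x(n+1)² = 1 + x² `y₂`.
y₂-factor : ∀ n → y₂ n ≡ y n * y n * (1ℚ + x n * x n * y₂ n)
y₂-factor n = begin
  y₂ n                                                   ≡⟨ eq₁ (y n) (y₂ n) ⟩
  y n - (y n - y₂ n)                                     ≡⟨ cong (_-_ (y n)) (y-y₂ n) ⟩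
  y n - x n * (y n * y₂ n)                               ≡⟨ eq₂ (x n) (y n) (y₂ n) ⟩
  y n * (y n + (1ℚ - y n) - x n * y₂ n)                  ≡⟨ cong (λ z → y n * (y n + z - x n * y₂ n)) (1-y n) ⟩
  y n * (y n + x n * y n - x n * y₂ n)                   ≡⟨ eq₃ (x n) (y n) (y₂ n) ⟩
  y n * (y n + x n * (y n - y₂ n))                       ≡⟨ cong (λ z → y n * (y n + x n * z)) (y-y₂ n) ⟩
  y n * (y n + x n * (x n * (y n * y₂ n)))               ≡⟨ eq₄ (x n) (y n) (y₂ n) ⟩
  y n * y n * (1ℚ + x n * x n * y₂ n)                    ∎
  where
  open ≡-Reasoning
  eq₁ : ∀ y g → g ≡ y - (y - g)
  eq₁ = solve-∀ ℚ-ring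
  eq₂ : ∀ x y g → y - x * (y * g) ≡ y * (y + (1ℚ - y) - x * g)
  eq₂ = solve-∀ ℚ-ring
  eq₃ : ∀ x y g → y * (y + x * y - x * g) ≡ y * (y + x * (y - g))
  eq₃ = solve-∀ ℚ-ring
  eq₄ : ∀ x y g → y * (y + x * (x * (y * g))) ≡ y * y * (1ℚ + x * x * g)
  eq₄ = solve-∀ ℚ-ring

scale² : Seq → Seq
scale² a n = toℚ (suc n) * toℚ (suc n) * a n

x²-scale² : ∀ a n → x n * x n * scale² a n ≡ a n
x²-scale² a n = trans (eq (x n) (toℚ (suc n)) (a n)) (trans (cong (λ z → z * z * a n) (n+1·x n)) (eq′ (a n)))
  where
  eq : ∀ x t a → x * x * (t * t * a) ≡ (t * x) * (t * x) * a
  eq = solve-∀ ℚ-ring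
  eq′ : ∀ a → 1ℚ * 1ℚ * a ≡ a
  eq′ = solve-∀ ℚ-ring

scale²-≈ : ∀ {a b} → Eventually (λ n → a n ≡ x n * x n * b n) → scale² a ≈ b
scale²-≈ {a} {b} = ev-map λ n p → trans (cong (toℚ (suc n) * toℚ (suc n) *_) p) (trans (eq (x n) (toℚ (suc n)) (b n)) (trans (cong (λ z → z * z * b n) (n+1·x n)) (eq′ (b n))))
  where
  eq : ∀ x t a → t * t * (x * x * a) ≡ (t * x) * (t * x) * a
  eq = solve-∀ ℚ-ring
  eq′ : ∀ a → 1ℚ * 1ℚ * a ≡ a
  eq′ = solve-∀ ℚ-ring

-- For s = c + e x + f x² the terms c² cancel, the linear part enters as c e times the second
-- difference of x, which is O(x³), and the remaining coefficient of x² tends to c(f₀ - 2f₀ + f₀) +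
-- e² - e² = 0. Reaching f is what costs two orders.
𝓛-exp : ∀ K {c s} → Exp⁺ (suc (suc K)) c s → Exp⁺ K 0ℚ (scale² (𝓛 s))
𝓛-exp K {c} {s} (exp⁺ d s≈ (expansion e (exp⁺ f d≈ (expansion f₀ F)))) =
  exp⁺-resp-≈ K (ev-map (λ _ → sym) (scale²-≈ (ev-map₃ (λ n p₀ p₁ p₂ → begin
      s n * s (suc (suc n)) - s (suc n) * s (suc n)
        ≡⟨ cong₂ (λ u v → u * v - s (suc n) * s (suc n)) p₀ p₂ ⟩
      (c + x n * (e + x n * f n)) * (c + x (suc (suc n)) * (e + x (suc (suc n)) * f₂ n)) - s (suc n) * s (suc n)
        ≡⟨ cong₂ (λ u v → (c + x n * (e + x n * f n)) * (c + u * (e + u * f₂ n)) - v * v) (x-suc² n) (trans p₁ (cong (λ z → c + z * (e + z * f₁ n)) (x-suc n))) ⟩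
      (c + x n * (e + x n * f n)) * (c + x n * y₂ n * (e + x n * y₂ n * f₂ n))
      - (c + x n * y n * (e + x n * y n * f₁ n)) * (c + x n * y n * (e + x n * y n * f₁ n))
        ≡⟨ eq₁ c e (x n) (y n) (y₂ n) (f n) (f₁ n) (f₂ n) ⟩
      c * e * x n * (1ℚ - toℚ 2 * y n + y₂ n) + x n * x n * rest n
        ≡⟨ cong (λ z → c * e * x n * z + x n * x n * rest n) (y-second-difference n) ⟩
      c * e * x n * (x n * x n * (y n * y n * (1ℚ + y₂ n))) + x n * x n * rest n
        ≡⟨ eq₂ (c * e) (x n) (y n * y n * (1ℚ + y₂ n)) (rest n) ⟩
      x n * x n * (x n * (c * e * (y n * y n * (1ℚ + y₂ n))) + rest n) ∎)
    s-expand (ev-suc s-expand) (ev-suc (ev-suc s-expand)))))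
  (exp⁺-head (eq₃ c e f₀) (exp⁺-+ K
    (exp⁺-* K (exp-x K) (exp⁺-* K (exp⁺-const K (c * e)) (exp⁺-* K (exp⁺-* K Y Y) (exp⁺-+ K (exp⁺-const K 1ℚ) Y₂))))
    (exp⁺-+ K
      (exp⁺-+ K
        (exp⁺-* K (exp⁺-const K c) (exp⁺-+ K (exp⁺-+ K F (exp⁺-* K (exp⁺-* K Y₂ Y₂) F₂)) (exp⁺-* K (exp⁺-const K (- toℚ 2)) (exp⁺-* K (exp⁺-* K Y Y) F₁))))
        (exp⁺-* K Y₂ (exp⁺-* K (exp⁺-+ K E (exp⁺-* K X F)) (exp⁺-+ K E (exp⁺-* K X (exp⁺-* K Y₂ F₂))))))
      (exp⁺-* K (exp⁺-const K (- 1ℚ)) (exp⁺-* K (exp⁺-* K Y Y) (exp⁺-* K Z Z))))))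
  where
  open ≡-Reasoning
  f₁ f₂ rest : Seq
  f₁ = f ∘ suc
  f₂ = f₁ ∘ suc
  rest = const c ⊗ (f ⊕ y₂ ⊗ y₂ ⊗ f₂ ⊕ const (- toℚ 2) ⊗ (y ⊗ y ⊗ f₁))
       ⊕ y₂ ⊗ ((const e ⊕ x ⊗ f) ⊗ (const e ⊕ x ⊗ (y₂ ⊗ f₂)))
       ⊕ const (- 1ℚ) ⊗ (y ⊗ y ⊗ ((const e ⊕ x ⊗ (y ⊗ f₁)) ⊗ (const e ⊕ x ⊗ (y ⊗ f₁))))
  X = exp-x K
  Y = exp⁺-y K
  Y₂ = exp⁺-y₂ K
  E = exp⁺-const K e
  F₁ = exp⁺-suc K F
  F₂ = exp⁺-suc K F₁
  Z = exp⁺-+ K E (exp⁺-* K X (exp⁺-* K Y F₁))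
  s-expand : Eventually (λ n → s n ≡ c + x n * (e + x n * f n))
  s-expand = ev-map₂ (λ n p q → trans p (cong (λ z → c + x n * z) q)) s≈ d≈
  eq₁ : ∀ c e x y g f f₁ f₂ →
    (c + x * (e + x * f)) * (c + x * g * (e + x * g * f₂)) - (c + x * y * (e + x * y * f₁)) * (c + x * y * (e + x * y * f₁))
    ≡ c * e * x * (1ℚ - toℚ 2 * y + g) + x * x *
      (c * (f + g * g * f₂ + - toℚ 2 * (y * y * f₁)) + g * ((e + x * f) * (e + x * (g * f₂)))
       + - 1ℚ * (y * y * ((e + x * (y * f₁)) * (e + x * (y * f₁)))))
  eq₁ = solve-∀ ℚ-ring
  eq₂ : ∀ a x b r → a * x * (x * x * b) + x * x * r ≡ x * x * (x * (a * b) + r)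
  eq₂ = solve-∀ ℚ-ring
  eq₃ : ∀ c e f →
    0ℚ * (c * e * (1ℚ * 1ℚ * (1ℚ + 1ℚ)))
    + (c * (f + 1ℚ * 1ℚ * f + - toℚ 2 * (1ℚ * 1ℚ * f)) + 1ℚ * ((e + 0ℚ * f) * (e + 0ℚ * (1ℚ * f)))
       + - 1ℚ * (1ℚ * 1ℚ * ((e + 0ℚ * (1ℚ * f)) * (e + 0ℚ * (1ℚ * f))))) ≡ 0ℚ
  eq₃ = solve-∀ ℚ-ring


module Step {a : Seq} (W : AsympLogConvexWitness a) where

  -- `j` is the reciprocal of s(n+1). `t` and `m` are chosen so that s(n) s(n+2) = s(n+1)² (1 + x²
  -- t) and 𝓛 a(n+1) = x² m a(n+2)²; the latter gives a(n+1) a(n+3) = a(n+2)² (1 + x² m).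
  s j t m : Seq
  s = ratio W
  j n = inv (s (suc n))
  t = scale² (𝓛 s) ⊗ (j ⊗ j)
  m = y ⊗ (y ⊗ (s ∘ suc))

  s-positive : Eventually (λ n → 0ℚ < s n)
  s-positive with ratio-exp W 0
  ... | c , 0<c , S = exp⁺-pos 0 0<c S

  sj≡1 : (s ∘ suc) ⊗ j ≈ const 1ℚ
  sj≡1 = ev-map (λ n → p*inv[p] (s (suc n))) (ev-suc s-positive)

  𝓛-positive : Eventually (λ n → 0ℚ < 𝓛 a n)
  𝓛-positive = ev-map₃ (λ n p q r → subst (0ℚ <_) (sym p)
      (*-pos {x n * x n * s n} {a (suc n) * a (suc n)} (*-pos {x n * x n} {s n} (*-pos (0<x n) (0<x n)) q) (*-pos r r)))
    (𝓛-ratio W) s-positive (ev-suc (ev-pos W))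

  -- One entry for each factor of `𝓛 a`: x² gives `y₂` twice, s gives `t`, and the square of a(n+1)
  -- gives `m` twice. The constant terms add up to 1 + 1 + 0 + c + c.
  new : Seq
  new = y₂ ⊞ y₂ ⊞ t ⊞ (m ⊞ m)

  new-exp′ : ∀ K {c c′} → 0ℚ < c → c * c′ ≡ 1ℚ → Exp⁺ (suc (suc K)) c s → Exp⁺ K (toℚ 2 + (c + c)) new
  new-exp′ K {c} {c′} 0<c cc′≡1 S = exp⁺-head {K} {1ℚ + 1ℚ + 0ℚ * (c′ * c′) + (1ℚ * (1ℚ * c) + 1ℚ * (1ℚ * c))} {toℚ 2 + (c + c)} {new} (eq c c′)
    (exp⁺-⊞ {y₂ ⊞ y₂ ⊞ t} {m ⊞ m} {1ℚ + 1ℚ + 0ℚ * (c′ * c′)} {1ℚ * (1ℚ * c) + 1ℚ * (1ℚ * c)} K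
      (exp⁺-⊞ {y₂ ⊞ y₂} {t} {1ℚ + 1ℚ} {0ℚ * (c′ * c′)} K (exp⁺-⊞ {y₂} {y₂} {1ℚ} {1ℚ} K (exp⁺-y₂ K) (exp⁺-y₂ K)) τ)
      (exp⁺-⊞ {m} {m} {1ℚ * (1ℚ * c)} {1ℚ * (1ℚ * c)} K M M))
    where
    S′ : Exp⁺ K c (s ∘ suc)
    S′ = exp⁺-suc K (exp⁺-weaken K (exp⁺-weaken (suc K) S))
    J : Exp⁺ K c′ j
    J = exp⁺-inverse {s ∘ suc} {j} K {c} {c′} 0<c cc′≡1 sj≡1 S′
    τ : Exp⁺ K (0ℚ * (c′ * c′)) t
    τ = exp⁺-* {scale² (𝓛 s)} {j ⊗ j} K {0ℚ} {c′ * c′} (𝓛-exp K S) (exp⁺-* {j} {j} K {c′} {c′} J J)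
    M : Exp⁺ K (1ℚ * (1ℚ * c)) m
    M = exp⁺-* {y} {y ⊗ (s ∘ suc)} K {1ℚ} {1ℚ * c} (exp⁺-y K) (exp⁺-* {y} {s ∘ suc} K {1ℚ} {c} (exp⁺-y K) S′)
    eq : ∀ c c′ → 1ℚ + 1ℚ + 0ℚ * (c′ * c′) + (1ℚ * (1ℚ * c) + 1ℚ * (1ℚ * c)) ≡ toℚ 2 + (c + c)
    eq = solve-∀ ℚ-ring

  new-exp : ∀ K → Σ[ c ∈ ℚ ] 0ℚ < c × Exp⁺ K c new
  new-exp K = let (c , 0<c , S) = ratio-exp W (suc (suc K)) ; (c′ , _ , cc′≡1) = inverse c 0<c in
    toℚ 2 + (c + c) , +-mono-< {0ℚ} {toℚ 2} {0ℚ} {c + c} (toWitness {a? = 0ℚ <? toℚ 2} _) (+-mono-< {0ℚ} {c} {0ℚ} {c} 0<c 0<c) ,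
    new-exp′ K 0<c cc′≡1 S

  new-factor : ∀ n → let X = x n * x n in
    1ℚ + X * new n ≡ (1ℚ + X * y₂ n) * (1ℚ + X * y₂ n) * (1ℚ + X * t n) * ((1ℚ + X * m n) * (1ℚ + X * m n))
  new-factor n = trans (1+x²⊞ (y₂ ⊞ y₂ ⊞ t) (m ⊞ m) n) (cong₂ _*_
    (trans (1+x²⊞ (y₂ ⊞ y₂) t n) (cong (_* (1ℚ + x n * x n * t n)) (1+x²⊞ y₂ y₂ n))) (1+x²⊞ m m n))

  ratio-𝓛 : Eventually (λ n → s n * s (suc (suc n)) ≡ s (suc n) * s (suc n) * (1ℚ + x n * x n * t n))
  ratio-𝓛 = ev-map (λ n p → begin
    s n * s (suc (suc n))
      ≡⟨ eq₁ (s n) (s (suc n)) (s (suc (suc n))) ⟩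
    s (suc n) * s (suc n) + 𝓛 s n
      ≡⟨ cong (_+_ (s (suc n) * s (suc n))) (eq₂ (𝓛 s n)) ⟩
    s (suc n) * s (suc n) + 𝓛 s n * (1ℚ * 1ℚ)
      ≡⟨ cong₂ (λ u v → s (suc n) * s (suc n) + u * (v * v)) (x²-scale² (𝓛 s) n) p ⟨
    s (suc n) * s (suc n) + x n * x n * scale² (𝓛 s) n * ((s (suc n) * j n) * (s (suc n) * j n))
      ≡⟨ eq₃ (s (suc n)) (x n * x n) (scale² (𝓛 s) n) (j n) ⟩
    s (suc n) * s (suc n) * (1ℚ + x n * x n * t n) ∎) sj≡1
    where
    open ≡-Reasoning
    eq₁ : ∀ s s₁ s₂ → s * s₂ ≡ s₁ * s₁ + (s * s₂ - s₁ * s₁)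
    eq₁ = solve-∀ ℚ-ring
    eq₂ : ∀ a → a ≡ a * (1ℚ * 1ℚ)
    eq₂ = solve-∀ ℚ-ring
    eq₃ : ∀ s X w j → s * s + X * w * ((s * j) * (s * j)) ≡ s * s * (1ℚ + X * (w * (j * j)))
    eq₃ = solve-∀ ℚ-ring

  𝓛-new : Eventually (λ n → 𝓛 (𝓛 a) n ≡ x n * x n * new n * (𝓛 a (suc n) * 𝓛 a (suc n)))
  𝓛-new = ev-map₂ (λ n (p₀ , p₁ , p₂) q → let
      X = x n * x n ; a₁ = a (suc n) ; a₂ = a (suc (suc n)) ; a₃ = a (suc (suc (suc n)))
      s₀ = s n ; s₁ = s (suc n) ; s₂ = s (suc (suc n)) ; L₁ = 𝓛 a (suc n)
      L₁≡ : L₁ ≡ X * m n * (a₂ * a₂)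
      L₁≡ = trans p₁ (trans (cong (λ z → z * z * s₁ * (a₂ * a₂)) (x-suc n)) (eq₀ (x n) (y n) s₁ (a₂ * a₂)))
    in begin
    𝓛 a n * 𝓛 a (suc (suc n)) - L₁ * L₁
      ≡⟨ cong₂ (λ u v → u * v - L₁ * L₁) p₀ (trans p₂ (cong (λ z → z * z * s₂ * (a₃ * a₃)) (x-suc² n))) ⟩
    x n * x n * s₀ * (a₁ * a₁) * (x n * y₂ n * (x n * y₂ n) * s₂ * (a₃ * a₃)) - L₁ * L₁
      -- Writing a₁ a₃ as (a₁ a₃ - a₂²) + a₂² makes L₁ appear, so that everything is measured by
      -- a₂².
      ≡⟨ eq₁ (x n) s₀ a₁ a₂ (y₂ n) s₂ a₃ L₁ ⟩
    X * X * (y₂ n * y₂ n) * (s₀ * s₂) * ((L₁′ a₁ a₂ a₃ + a₂ * a₂) * (L₁′ a₁ a₂ a₃ + a₂ * a₂)) - L₁ * L₁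
      ≡⟨ cong₂ (λ u v → X * X * (u * u) * (s₀ * s₂) * ((v + a₂ * a₂) * (v + a₂ * a₂)) - v * v) (y₂-factor n) L₁≡ ⟩
    X * X * (y n * y n * (1ℚ + X * y₂ n) * (y n * y n * (1ℚ + X * y₂ n))) * (s₀ * s₂)
      * ((X * m n * (a₂ * a₂) + a₂ * a₂) * (X * m n * (a₂ * a₂) + a₂ * a₂)) - X * m n * (a₂ * a₂) * (X * m n * (a₂ * a₂))
      ≡⟨ cong (λ z → X * X * (y n * y n * (1ℚ + X * y₂ n) * (y n * y n * (1ℚ + X * y₂ n))) * z
               * ((X * m n * (a₂ * a₂) + a₂ * a₂) * (X * m n * (a₂ * a₂) + a₂ * a₂)) - X * m n * (a₂ * a₂) * (X * m n * (a₂ * a₂))) q ⟩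
    X * X * (y n * y n * (1ℚ + X * y₂ n) * (y n * y n * (1ℚ + X * y₂ n))) * (s₁ * s₁ * (1ℚ + X * t n))
      * ((X * m n * (a₂ * a₂) + a₂ * a₂) * (X * m n * (a₂ * a₂) + a₂ * a₂)) - X * m n * (a₂ * a₂) * (X * m n * (a₂ * a₂))
      ≡⟨ eq₂ X (y n) (1ℚ + X * y₂ n) s₁ (1ℚ + X * t n) (a₂ * a₂) ⟩
    ((1ℚ + X * y₂ n) * (1ℚ + X * y₂ n) * (1ℚ + X * t n) * ((1ℚ + X * m n) * (1ℚ + X * m n)) - 1ℚ) * (X * m n * (a₂ * a₂) * (X * m n * (a₂ * a₂)))
      ≡⟨ cong₂ (λ u v → (u - 1ℚ) * (v * v)) (sym (new-factor n)) (sym L₁≡) ⟩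
    (1ℚ + X * new n - 1ℚ) * (L₁ * L₁)
      ≡⟨ eq₃ (X * new n) (L₁ * L₁) ⟩
    X * new n * (L₁ * L₁) ∎)
    (ev-map₃ (λ _ p q r → p , (q , r)) (𝓛-ratio W) (ev-suc (𝓛-ratio W)) (ev-suc (ev-suc (𝓛-ratio W)))) ratio-𝓛
    where
    open ≡-Reasoning
    L₁′ : ℚ → ℚ → ℚ → ℚ
    L₁′ a₁ a₂ a₃ = a₁ * a₃ - a₂ * a₂
    eq₀ : ∀ x y s b → x * y * (x * y) * s * b ≡ x * x * (y * (y * s)) * b
    eq₀ = solve-∀ ℚ-ring
    eq₁ : ∀ x s₀ a₁ a₂ g s₂ a₃ L → x * x * s₀ * (a₁ * a₁) * (x * g * (x * g) * s₂ * (a₃ * a₃)) - L * L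
      ≡ x * x * (x * x) * (g * g) * (s₀ * s₂) * ((a₁ * a₃ - a₂ * a₂ + a₂ * a₂) * (a₁ * a₃ - a₂ * a₂ + a₂ * a₂)) - L * L
    eq₁ = solve-∀ ℚ-ring
    eq₂ : ∀ X y G s τ b →
      X * X * (y * y * G * (y * y * G)) * (s * s * τ) * ((X * (y * (y * s)) * b + b) * (X * (y * (y * s)) * b + b)) - X * (y * (y * s)) * b * (X * (y * (y * s)) * b)
      ≡ (G * G * τ * ((1ℚ + X * (y * (y * s))) * (1ℚ + X * (y * (y * s)))) - 1ℚ) * (X * (y * (y * s)) * b * (X * (y * (y * s)) * b))
    eq₂ = solve-∀ ℚ-ring
    eq₃ : ∀ w b → (1ℚ + w - 1ℚ) * b ≡ w * b
    eq₃ = solve-∀ ℚ-ring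

  witness : AsympLogConvexWitness (𝓛 a)
  witness = record { ev-pos = 𝓛-positive ; ratio = new ; 𝓛-ratio = 𝓛-new ; ratio-exp = new-exp }

𝓛^-witness : ∀ {a} j → AsympLogConvexWitness a → AsympLogConvexWitness (𝓛^ j a)
𝓛^-witness zero    W = W
𝓛^-witness (suc j) W = Step.witness (𝓛^-witness j W)

witness⇒asympLogConvex : ∀ {a} r → AsympLogConvexWitness a → AsympLogConvex r a
witness⇒asympLogConvex {a} r W j _ _ with ev-pos (𝓛^-witness j W)
... | N , 0<𝓛 = N , λ n N≤n → <⇒≤ (0<𝓛 n N≤n)

-- The ratio of consecutive Baxter numbers

0<toℚ-suc : ∀ d → 0ℚ < toℚ (suc d)
0<toℚ-suc d = positive⁻¹ (toℚ (suc d)) {{normalize-pos (suc d) 1}}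

0<n+d : ∀ n d → 0ℚ < toℚ n + toℚ (suc d)
0<n+d n d = +-mono-≤-< {0ℚ} {toℚ n} {0ℚ} {toℚ (suc d)} (0≤toℚ n) (0<toℚ-suc d)

recD-pos : ∀ n → 0ℚ < recD (toℚ n)
recD-pos n = *-pos (0<n+d n 4) (0<n+d n 5)

recQ-pos : ∀ n → 0ℚ < recQ (toℚ n)
recQ-pos n = *-pos {toℚ 8 * (toℚ n + 1ℚ)} {toℚ n + toℚ 2} (*-pos {toℚ 8} {toℚ n + 1ℚ} (0<toℚ-suc 7) (0<n+d n 0)) (0<n+d n 1)

recP-pos : ∀ n → 0ℚ < recP (toℚ n)
recP-pos n = subst (0ℚ <_) (sym (eq z)) (+-mono-≤-< {0ℚ} {toℚ 7 * z * z + toℚ 49 * z} {0ℚ} {toℚ 82}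
    (+-nonNeg {toℚ 7 * z * z} {toℚ 49 * z} (*-nonNeg {toℚ 7 * z} {z} (*-nonNeg {toℚ 7} {z} (0≤toℚ 7) (0≤toℚ n)) (0≤toℚ n))
              (*-nonNeg {toℚ 49} {z} (0≤toℚ 49) (0≤toℚ n)))
    (0<toℚ-suc 81))
  where
  z = toℚ n
  eq : ∀ z → toℚ 7 * (z + toℚ 3) * (z + toℚ 3) + toℚ 7 * (z + toℚ 3) - toℚ 2 ≡ toℚ 7 * z * z + toℚ 49 * z + toℚ 82
  eq = solve-∀ ℚ-ring

β : Seq
β = baxterSeq

β₀≡1 : β 0 ≡ 1ℚ
β₀≡1 = refl

β₁≡2 : β 1 ≡ toℚ 2
β₁≡2 = refl

β-pos² : ∀ n → 0ℚ < β n × 0ℚ < β (suc n)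
β-pos² zero = subst (0ℚ <_) (sym β₀≡1) (0<toℚ-suc 0) , subst (0ℚ <_) (sym β₁≡2) (0<toℚ-suc 1)
β-pos² (suc n) = let (0<β , 0<β′) = β-pos² n in 0<β′ ,
  *-cancelˡ-<-nonNeg (recD (toℚ n)) {{nonNegative (<⇒≤ (recD-pos n))}}
    (subst₂ _<_ (sym (*-zeroʳ (recD (toℚ n)))) (sym (baxter-recurrence n))
      (+-mono-< {0ℚ} {recP (toℚ n) * β (suc n)} {0ℚ} {recQ (toℚ n) * β n} (*-pos (recP-pos n) 0<β′) (*-pos (recQ-pos n) 0<β)))

β-pos : ∀ n → 0ℚ < β n
β-pos n = proj₁ (β-pos² n)

-- The quotient x(k+n)/x(n) = (n+1)/(n+k+1). It puts the poles 1/(n+5) and 1/(n+6) of the recurrence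
-- into the variable x n.
x-shift : ℕ → Seq
x-shift zero    = const 1ℚ
x-shift (suc k) = x-shift k ⊗ (λ n → y (k ℕ.+ n))

x-shift-spec : ∀ k n → x (k ℕ.+ n) ≡ x n * x-shift k n
x-shift-spec zero    n = sym (*-identityʳ (x n))
x-shift-spec (suc k) n = trans (x-suc (k ℕ.+ n)) (trans (cong (_* y (k ℕ.+ n)) (x-shift-spec k n)) (*-assoc (x n) (x-shift k n) (y (k ℕ.+ n))))

exp⁺-x-shift : ∀ K k → Exp⁺ K 1ℚ (x-shift k)
exp⁺-x-shift K zero    = exp⁺-const K 1ℚ
exp⁺-x-shift K (suc k) = exp⁺-* {x-shift k} {λ n → y (k ℕ.+ n)} K {1ℚ} {1ℚ} (exp⁺-x-shift K k) (shifted k)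
  where
  shifted : ∀ k → Exp⁺ K 1ℚ (λ n → y (k ℕ.+ n))
  shifted zero    = exp⁺-y K
  shifted (suc k) = exp⁺-resp-≈ {λ n → y (k ℕ.+ suc n)} {λ n → y (suc k ℕ.+ n)} K {1ℚ} (always λ n → cong y (ℕP.+-suc k n)) (exp⁺-suc K (shifted k))

ρ ρ⁻¹ p₁ q₁ : Seq
ρ n = β (suc n) * inv (β n)
ρ⁻¹ n = β n * inv (β (suc n))
p₁ = const (toℚ 12) ⊗ x-shift 4 ⊕ const (- toℚ 40) ⊗ x-shift 5
q₁ = const (toℚ 96) ⊗ x-shift 4 ⊕ const (- toℚ 160) ⊗ x-shift 5

β-inv : ∀ n → β n * inv (β n) ≡ 1ℚ
β-inv n = p*inv[p] (β n) (β-pos n)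

ρρ⁻¹≡1 : ∀ n → ρ n * ρ⁻¹ n ≡ 1ℚ
ρρ⁻¹≡1 n = trans (eq (β n) (β (suc n)) (inv (β n)) (inv (β (suc n)))) (cong₂ _*_ (β-inv (suc n)) (β-inv n))
  where
  eq : ∀ b b′ v v′ → b′ * v * (b * v′) ≡ (b′ * v′) * (b * v)
  eq = solve-∀ ℚ-ring

0<ρ⁻¹ : ∀ n → 0ℚ < ρ⁻¹ n
0<ρ⁻¹ n = *-pos (β-pos n) (inv-pos (β (suc n)) (β-pos (suc n)))

n+d·x : ∀ d n → (toℚ n + toℚ (suc d)) * x (d ℕ.+ n) ≡ 1ℚ
n+d·x d n = trans (cong (_* x (d ℕ.+ n)) (trans (sym (toℚ-+ n (suc d))) (cong toℚ (ℕP.+-comm n (suc d))))) (n+1·x (d ℕ.+ n))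

-- Partial fractions: recP/recD = 7 + 12/(n+5) - 40/(n+6) and recQ/recD = 8 + 96/(n+5) - 160/(n+6).
β-step : ∀ n → β (suc (suc n)) ≡ (toℚ 7 + x n * p₁ n) * β (suc n) + (toℚ 8 + x n * q₁ n) * β n
β-step n = begin
  b₂                                           ≡⟨ eq₁ b₂ ⟩
  1ℚ * 1ℚ * b₂                                 ≡⟨ cong₂ (λ u v → u * v * b₂) (n+d·x 4 n) (n+d·x 5 n) ⟨
  (z + toℚ 5) * t₅ * ((z + toℚ 6) * t₆) * b₂   ≡⟨ eq₂ (z + toℚ 5) (z + toℚ 6) t₅ t₆ b₂ ⟩
  t₅ * t₆ * (recD z * b₂)                      ≡⟨ cong (t₅ * t₆ *_) (baxter-recurrence n) ⟩
  t₅ * t₆ * (recP z * b₁ + recQ z * b₀)        ≡⟨ eq₃ z t₅ t₆ b₀ b₁ ⟩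
  (toℚ 7 * (((z + toℚ 5) * t₅) * ((z + toℚ 6) * t₆)) + (toℚ 12 * t₅ * ((z + toℚ 6) * t₆) + - toℚ 40 * t₆ * ((z + toℚ 5) * t₅))) * b₁
  + (toℚ 8 * (((z + toℚ 5) * t₅) * ((z + toℚ 6) * t₆)) + (toℚ 96 * t₅ * ((z + toℚ 6) * t₆) + - toℚ 160 * t₆ * ((z + toℚ 5) * t₅))) * b₀
    ≡⟨ cong₂ (λ u v → (toℚ 7 * (u * v) + (toℚ 12 * t₅ * v + - toℚ 40 * t₆ * u)) * b₁ + (toℚ 8 * (u * v) + (toℚ 96 * t₅ * v + - toℚ 160 * t₆ * u)) * b₀) (n+d·x 4 n) (n+d·x 5 n) ⟩
  (toℚ 7 * (1ℚ * 1ℚ) + (toℚ 12 * t₅ * 1ℚ + - toℚ 40 * t₆ * 1ℚ)) * b₁ + (toℚ 8 * (1ℚ * 1ℚ) + (toℚ 96 * t₅ * 1ℚ + - toℚ 160 * t₆ * 1ℚ)) * b₀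
    ≡⟨ cong₂ (λ u v → (toℚ 7 * (1ℚ * 1ℚ) + (toℚ 12 * u * 1ℚ + - toℚ 40 * v * 1ℚ)) * b₁ + (toℚ 8 * (1ℚ * 1ℚ) + (toℚ 96 * u * 1ℚ + - toℚ 160 * v * 1ℚ)) * b₀) (x-shift-spec 4 n) (x-shift-spec 5 n) ⟩
  (toℚ 7 * (1ℚ * 1ℚ) + (toℚ 12 * (x n * x-shift 4 n) * 1ℚ + - toℚ 40 * (x n * x-shift 5 n) * 1ℚ)) * b₁ + (toℚ 8 * (1ℚ * 1ℚ) + (toℚ 96 * (x n * x-shift 4 n) * 1ℚ + - toℚ 160 * (x n * x-shift 5 n) * 1ℚ)) * b₀
    ≡⟨ eq₄ (x n) (x-shift 4 n) (x-shift 5 n) b₀ b₁ ⟩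
  (toℚ 7 + x n * p₁ n) * b₁ + (toℚ 8 + x n * q₁ n) * b₀ ∎
  where
  open ≡-Reasoning
  z = toℚ n
  t₅ = x (4 ℕ.+ n)
  t₆ = x (5 ℕ.+ n)
  b₀ = β n
  b₁ = β (suc n)
  b₂ = β (suc (suc n))
  eq₁ : ∀ b → b ≡ 1ℚ * 1ℚ * b
  eq₁ = solve-∀ ℚ-ring
  eq₂ : ∀ a c s t b → a * s * (c * t) * b ≡ s * t * (a * c * b)
  eq₂ = solve-∀ ℚ-ring
  eq₃ : ∀ z s t b₀ b₁ →
    s * t * ((toℚ 7 * (z + toℚ 3) * (z + toℚ 3) + toℚ 7 * (z + toℚ 3) - toℚ 2) * b₁ + (toℚ 8 * (z + 1ℚ) * (z + toℚ 2)) * b₀)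
    ≡ (toℚ 7 * (((z + toℚ 5) * s) * ((z + toℚ 6) * t)) + (toℚ 12 * s * ((z + toℚ 6) * t) + - toℚ 40 * t * ((z + toℚ 5) * s))) * b₁
      + (toℚ 8 * (((z + toℚ 5) * s) * ((z + toℚ 6) * t)) + (toℚ 96 * s * ((z + toℚ 6) * t) + - toℚ 160 * t * ((z + toℚ 5) * s))) * b₀
  eq₃ = solve-∀ ℚ-ring
  eq₄ : ∀ x s t b₀ b₁ →
    (toℚ 7 * (1ℚ * 1ℚ) + (toℚ 12 * (x * s) * 1ℚ + - toℚ 40 * (x * t) * 1ℚ)) * b₁ + (toℚ 8 * (1ℚ * 1ℚ) + (toℚ 96 * (x * s) * 1ℚ + - toℚ 160 * (x * t) * 1ℚ)) * b₀
    ≡ (toℚ 7 + x * (toℚ 12 * s + - toℚ 40 * t)) * b₁ + (toℚ 8 + x * (toℚ 96 * s + - toℚ 160 * t)) * b₀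
  eq₄ = solve-∀ ℚ-ring

riccati : ∀ n → ρ (suc n) ≡ (toℚ 7 + x n * p₁ n) + (toℚ 8 + x n * q₁ n) * ρ⁻¹ n
riccati n = begin
  β (suc (suc n)) * v                          ≡⟨ cong (_* v) (β-step n) ⟩
  (P * β (suc n) + Q * β n) * v                ≡⟨ eq₁ P Q (β (suc n)) (β n) v ⟩
  P * (β (suc n) * v) + Q * (β n * v)          ≡⟨ cong (λ z → P * z + Q * (β n * v)) (β-inv (suc n)) ⟩
  P * 1ℚ + Q * (β n * v)                       ≡⟨ cong (_+ Q * (β n * v)) (*-identityʳ P) ⟩
  P + Q * ρ⁻¹ n                                  ∎
  where
  open ≡-Reasoning
  v = inv (β (suc n))
  P = toℚ 7 + x n * p₁ n
  Q = toℚ 8 + x n * q₁ n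
  eq₁ : ∀ P Q b′ b v → (P * b′ + Q * b) * v ≡ P * (b′ * v) + Q * (b * v)
  eq₁ = solve-∀ ℚ-ring

shift-combination-exp : ∀ K c d → Exp⁺ K (c * 1ℚ + d * 1ℚ) (const c ⊗ x-shift 4 ⊕ const d ⊗ x-shift 5)
shift-combination-exp K c d = exp⁺-+ {const c ⊗ x-shift 4} {const d ⊗ x-shift 5} K {c * 1ℚ} {d * 1ℚ}
  (exp⁺-* {const c} {x-shift 4} K {c} {1ℚ} (exp⁺-const K c) (exp⁺-x-shift K 4))
  (exp⁺-* {const d} {x-shift 5} K {d} {1ℚ} (exp⁺-const K d) (exp⁺-x-shift K 5))

open Riccati ρ ρ⁻¹ p₁ q₁ ρρ⁻¹≡1 0<ρ⁻¹ riccati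
  (λ K → shift-combination-exp K (toℚ 12) (- toℚ 40)) (λ K → shift-combination-exp K (toℚ 96) (- toℚ 160))

-- From b₀ b₂ / b₁² - 1 = (b₂/b₁ - b₁/b₀) · b₀/b₁, multiplied by (n+1)².
β-ratio : Seq
β-ratio = scale² (λ n → ρ (suc n) - ρ n) ⊗ ρ⁻¹

𝓛-β : ∀ n → 𝓛 β n ≡ x n * x n * β-ratio n * (β (suc n) * β (suc n))
𝓛-β n = begin
  b₀ * b₂ - b₁ * b₁                                       ≡⟨ eq₁ b₀ b₁ b₂ ⟩
  1ℚ * b₀ * b₂ - 1ℚ * b₁ * b₁ * 1ℚ                                  ≡⟨ cong₂ (λ u v → u * b₀ * b₂ - u * b₁ * b₁ * v) (β-inv (suc n)) (β-inv n) ⟨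
  (b₁ * v₁) * b₀ * b₂ - (b₁ * v₁) * b₁ * b₁ * (b₀ * v₀)   ≡⟨ cong (λ z → z * b₀ * b₂ - (b₁ * v₁) * b₁ * b₁ * (b₀ * v₀)) (trans (sym (*-identityʳ (b₁ * v₁))) (cong (b₁ * v₁ *_) (sym (β-inv (suc n))))) ⟩
  (b₁ * v₁ * (b₁ * v₁)) * b₀ * b₂ - (b₁ * v₁) * b₁ * b₁ * (b₀ * v₀)  ≡⟨ eq₂ b₀ b₁ b₂ v₀ v₁ ⟩
  (ρ (suc n) - ρ n) * ρ⁻¹ n * (b₁ * b₁)                     ≡⟨ cong (λ z → z * ρ⁻¹ n * (b₁ * b₁)) (x²-scale² (λ n → ρ (suc n) - ρ n) n) ⟨
  x n * x n * scale² (λ n → ρ (suc n) - ρ n) n * ρ⁻¹ n * (b₁ * b₁)  ≡⟨ eq₃ (x n * x n) (scale² (λ n → ρ (suc n) - ρ n) n) (ρ⁻¹ n) (b₁ * b₁) ⟩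
  x n * x n * β-ratio n * (b₁ * b₁)                       ∎
  where
  open ≡-Reasoning
  b₀ = β n
  b₁ = β (suc n)
  b₂ = β (suc (suc n))
  v₀ = inv b₀
  v₁ = inv b₁
  eq₁ : ∀ b₀ b₁ b₂ → b₀ * b₂ - b₁ * b₁ ≡ 1ℚ * b₀ * b₂ - 1ℚ * b₁ * b₁ * 1ℚ
  eq₁ = solve-∀ ℚ-ring
  eq₂ : ∀ b₀ b₁ b₂ v₀ v₁ → (b₁ * v₁ * (b₁ * v₁)) * b₀ * b₂ - (b₁ * v₁) * b₁ * b₁ * (b₀ * v₀)
        ≡ (b₂ * v₁ - b₁ * v₀) * (b₀ * v₁) * (b₁ * b₁)
  eq₂ = solve-∀ ℚ-ring
  eq₃ : ∀ X a ρ⁻¹ b → X * a * ρ⁻¹ * b ≡ X * (a * ρ⁻¹) * b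
  eq₃ = solve-∀ ℚ-ring

-- In ρ = 8 - 32x + f x² the linear term has increment 32 x² y, while the quadratic part contributes
-- x²(y² f(n+1) - f(n)), whose coefficient tends to f₀ - f₀ = 0.
ρ-difference-exp : ∀ K → Exp⁺ (suc K) (- toℚ 32) deviation → Exp⁺ K (toℚ 32) (scale² (λ n → ρ (suc n) - ρ n))
ρ-difference-exp K (exp⁺ f d≈ (expansion f₀ F)) =
  exp⁺-resp-≈ {diff} {scale² (λ n → ρ (suc n) - ρ n)} K (ev-map (λ _ → sym) (scale²-≈ {λ n → ρ (suc n) - ρ n} {diff} (ev-map₂ (λ n p q → begin
    ρ (suc n) - ρ n
      ≡⟨ cong₂ _-_ (trans (ρ-deviation (suc n)) (cong₂ (λ u v → toℚ 8 + u * v) (x-suc n) (trans q (cong (λ z → - toℚ 32 + z * f (suc n)) (x-suc n))))) (trans (ρ-deviation n) (cong (λ z → toℚ 8 + x n * z) p)) ⟩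
    toℚ 8 + x n * y n * (- toℚ 32 + x n * y n * f (suc n)) - (toℚ 8 + x n * (- toℚ 32 + x n * f n))
      ≡⟨ eq₁ (x n) (y n) (f n) (f (suc n)) ⟩
    x n * (toℚ 32 * (1ℚ - y n) + x n * (y n * y n * f (suc n) + - 1ℚ * f n))
      ≡⟨ cong (λ z → x n * (toℚ 32 * z + x n * (y n * y n * f (suc n) + - 1ℚ * f n))) (1-y n) ⟩
    x n * (toℚ 32 * (x n * y n) + x n * (y n * y n * f (suc n) + - 1ℚ * f n))
      ≡⟨ eq₂ (x n) (y n) (y n * y n * f (suc n)) (- 1ℚ * f n) ⟩
    x n * x n * diff n ∎) d≈ (ev-suc d≈))))
  (exp⁺-head {K} {toℚ 32 * 1ℚ + 1ℚ * 1ℚ * f₀ + - 1ℚ * f₀} {toℚ 32} {diff} (eq₃ f₀)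
    (exp⁺-+ {const (toℚ 32) ⊗ y ⊕ y ⊗ y ⊗ (f ∘ suc)} {const (- 1ℚ) ⊗ f} K {toℚ 32 * 1ℚ + 1ℚ * 1ℚ * f₀} { - 1ℚ * f₀}
      (exp⁺-+ {const (toℚ 32) ⊗ y} {y ⊗ y ⊗ (f ∘ suc)} K {toℚ 32 * 1ℚ} {1ℚ * 1ℚ * f₀}
        (exp⁺-* {const (toℚ 32)} {y} K {toℚ 32} {1ℚ} (exp⁺-const K (toℚ 32)) (exp⁺-y K))
        (exp⁺-* {y ⊗ y} {f ∘ suc} K {1ℚ * 1ℚ} {f₀} (exp⁺-* {y} {y} K {1ℚ} {1ℚ} (exp⁺-y K) (exp⁺-y K)) (exp⁺-suc K F)))
      (exp⁺-* {const (- 1ℚ)} {f} K { - 1ℚ} {f₀} (exp⁺-const K (- 1ℚ)) F)))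
  where
  open ≡-Reasoning
  diff : Seq
  diff = const (toℚ 32) ⊗ y ⊕ y ⊗ y ⊗ (f ∘ suc) ⊕ const (- 1ℚ) ⊗ f
  eq₁ : ∀ x y f f₁ → toℚ 8 + x * y * (- toℚ 32 + x * y * f₁) - (toℚ 8 + x * (- toℚ 32 + x * f))
        ≡ x * (toℚ 32 * (1ℚ - y) + x * (y * y * f₁ + - 1ℚ * f))
  eq₁ = solve-∀ ℚ-ring
  eq₂ : ∀ x y a b → x * (toℚ 32 * (x * y) + x * (a + b)) ≡ x * x * (toℚ 32 * y + a + b)
  eq₂ = solve-∀ ℚ-ring
  eq₃ : ∀ f → toℚ 32 * 1ℚ + 1ℚ * 1ℚ * f + - 1ℚ * f ≡ toℚ 32
  eq₃ = solve-∀ ℚ-ring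

β-witness : AsympLogConvexWitness β
β-witness = record
  { ev-pos    = always β-pos
  ; ratio     = β-ratio
  ; 𝓛-ratio   = always 𝓛-β
  ; ratio-exp = λ K → toℚ 32 * (+ 1 / 8) , toWitness {a? = 0ℚ <? toℚ 32 * (+ 1 / 8)} _ ,
      exp⁺-* {scale² (λ n → ρ (suc n) - ρ n)} {ρ⁻¹} K {toℚ 32} {+ 1 / 8} (ρ-difference-exp K (deviation-exp⁺ (suc K))) (ρ⁻¹-exp K)
  }

-- Nonnegative polynomials on [1, ∞)

infixl 6 _:+_ _:-_
infixl 7 _:*_

-- Polynomials as syntax: coefficients are obtained by normalisation, while `⟦_⟧` unfolds to the
-- very rational expressions that occur in the inequalities.
data Expr : Set where
  X              : Expr
  con            : ℕ → Expr
  _:+_ _:-_ _:*_ : Expr → Expr → Expr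

⟦_⟧ : Expr → ℚ → ℚ
⟦ X ⟧      z = z
⟦ con n ⟧  z = toℚ n
⟦ a :+ b ⟧ z = ⟦ a ⟧ z + ⟦ b ⟧ z
⟦ a :- b ⟧ z = ⟦ a ⟧ z - ⟦ b ⟧ z
⟦ a :* b ⟧ z = ⟦ a ⟧ z * ⟦ b ⟧ z

Poly : Set
Poly = List ℤ

eval : Poly → ℚ → ℚ
eval []      z = 0ℚ
eval (c ∷ p) z = ι c + z * eval p z

addP : Poly → Poly → Poly
addP []      q       = q
addP p       []      = p
addP (c ∷ p) (d ∷ q) = c ℤ.+ d ∷ addP p q

scaleP : ℤ → Poly → Poly
scaleP c []      = []
scaleP c (d ∷ p) = c ℤ.* d ∷ scaleP c p

mulP : Poly → Poly → Poly
mulP []      q = []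
mulP (c ∷ p) q = addP (scaleP c q) (+ 0 ∷ mulP p q)

eval-addP : ∀ p q z → eval (addP p q) z ≡ eval p z + eval q z
eval-addP []      q       z = sym (+-identityˡ (eval q z))
eval-addP (c ∷ p) []      z = sym (+-identityʳ (eval (c ∷ p) z))
eval-addP (c ∷ p) (d ∷ q) z = begin
  ι (c ℤ.+ d) + z * eval (addP p q) z           ≡⟨ cong₂ (λ u v → u + z * v) (ι-+ c d) (eval-addP p q z) ⟩
  ι c + ι d + z * (eval p z + eval q z)         ≡⟨ eq (ι c) (ι d) z (eval p z) (eval q z) ⟩
  ι c + z * eval p z + (ι d + z * eval q z)     ∎
  where
  open ≡-Reasoning
  eq : ∀ c d z p q → c + d + z * (p + q) ≡ c + z * p + (d + z * q)
  eq = solve-∀ ℚ-ring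

eval-scaleP : ∀ c p z → eval (scaleP c p) z ≡ ι c * eval p z
eval-scaleP c []      z = sym (*-zeroʳ (ι c))
eval-scaleP c (d ∷ p) z = begin
  ι (c ℤ.* d) + z * eval (scaleP c p) z   ≡⟨ cong₂ (λ u v → u + z * v) (ι-* c d) (eval-scaleP c p z) ⟩
  ι c * ι d + z * (ι c * eval p z)        ≡⟨ eq (ι c) (ι d) z (eval p z) ⟩
  ι c * (ι d + z * eval p z)              ∎
  where
  open ≡-Reasoning
  eq : ∀ c d z p → c * d + z * (c * p) ≡ c * (d + z * p)
  eq = solve-∀ ℚ-ring

eval-mulP : ∀ p q z → eval (mulP p q) z ≡ eval p z * eval q z
eval-mulP []      q z = sym (*-zeroˡ (eval q z))
eval-mulP (c ∷ p) q z = begin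
  eval (addP (scaleP c q) (+ 0 ∷ mulP p q)) z          ≡⟨ eval-addP (scaleP c q) (+ 0 ∷ mulP p q) z ⟩
  eval (scaleP c q) z + (0ℚ + z * eval (mulP p q) z)   ≡⟨ cong₂ (λ u v → u + (0ℚ + z * v)) (eval-scaleP c q z) (eval-mulP p q z) ⟩
  ι c * eval q z + (0ℚ + z * (eval p z * eval q z))    ≡⟨ eq (ι c) z (eval p z) (eval q z) ⟩
  (ι c + z * eval p z) * eval q z                      ∎
  where
  open ≡-Reasoning
  eq : ∀ c z p q → c * q + (0ℚ + z * (p * q)) ≡ (c + z * p) * q
  eq = solve-∀ ℚ-ring

-- Coefficients of ⟦ e ⟧ (1 + z): nonnegativity of all of them proves ⟦ e ⟧ ≥ 0 on [1, ∞).
expand₁ : Expr → Poly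
expand₁ X        = + 1 ∷ + 1 ∷ []
expand₁ (con n)  = + n ∷ []
expand₁ (a :+ b) = addP (expand₁ a) (expand₁ b)
expand₁ (a :- b) = addP (expand₁ a) (scaleP -[1+ 0 ] (expand₁ b))
expand₁ (a :* b) = mulP (expand₁ a) (expand₁ b)

expand₁-correct : ∀ e z → eval (expand₁ e) z ≡ ⟦ e ⟧ (z + 1ℚ)
expand₁-correct X z = eq z
  where
  eq : ∀ z → 1ℚ + z * (1ℚ + z * 0ℚ) ≡ z + 1ℚ
  eq = solve-∀ ℚ-ring
expand₁-correct (con n) z = eq (toℚ n) z
  where
  eq : ∀ n z → n + z * 0ℚ ≡ n
  eq = solve-∀ ℚ-ring
expand₁-correct (a :+ b) z = trans (eval-addP (expand₁ a) (expand₁ b) z) (cong₂ _+_ (expand₁-correct a z) (expand₁-correct b z))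
expand₁-correct (a :- b) z = begin
  eval (addP (expand₁ a) (scaleP -[1+ 0 ] (expand₁ b))) z      ≡⟨ eval-addP (expand₁ a) (scaleP -[1+ 0 ] (expand₁ b)) z ⟩
  eval (expand₁ a) z + eval (scaleP -[1+ 0 ] (expand₁ b)) z    ≡⟨ cong (_+_ (eval (expand₁ a) z)) (eval-scaleP -[1+ 0 ] (expand₁ b) z) ⟩
  eval (expand₁ a) z + - 1ℚ * eval (expand₁ b) z               ≡⟨ eq (eval (expand₁ a) z) (eval (expand₁ b) z) ⟩
  eval (expand₁ a) z - eval (expand₁ b) z                      ≡⟨ cong₂ _-_ (expand₁-correct a z) (expand₁-correct b z) ⟩
  ⟦ a ⟧ (z + 1ℚ) - ⟦ b ⟧ (z + 1ℚ)                              ∎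
  where
  open ≡-Reasoning
  eq : ∀ a b → a + - 1ℚ * b ≡ a - b
  eq = solve-∀ ℚ-ring
expand₁-correct (a :* b) z = trans (eval-mulP (expand₁ a) (expand₁ b) z) (cong₂ _*_ (expand₁-correct a z) (expand₁-correct b z))

nonNegative? : Poly → Bool
nonNegative? []             = true
nonNegative? (+ _      ∷ p) = nonNegative? p
nonNegative? (-[1+ _ ] ∷ p) = false

eval-nonNeg : ∀ p → T (nonNegative? p) → ∀ {z} → 0ℚ ≤ z → 0ℚ ≤ eval p z
eval-nonNeg []          _ 0≤z = ≤-refl
eval-nonNeg (+ n ∷ p)   h {z} 0≤z = +-nonNeg {toℚ n} {z * eval p z} (0≤toℚ n) (*-nonNeg {z} {eval p z} 0≤z (eval-nonNeg p h 0≤z))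
eval-nonNeg (-[1+ _ ] ∷ _) ()

-- On a concrete expression the test evaluates to `true`, so its hypothesis becomes the unit type
-- and is filled by `_`.
nonNeg₁ : ∀ e → T (nonNegative? (expand₁ e)) → ∀ n → 0ℚ ≤ ⟦ e ⟧ (toℚ (suc n))
nonNeg₁ e h n = subst (λ z → 0ℚ ≤ ⟦ e ⟧ z) (sym (toℚ-suc n))
  (subst (0ℚ ≤_) (expand₁-correct e (toℚ n)) (eval-nonNeg (expand₁ e) h (0≤toℚ n)))

-- Strictness comes from e ≥ 1, which the same weak test can certify.
pos₁ : ∀ e → T (nonNegative? (expand₁ (e :- con 1))) → ∀ n → 0ℚ < ⟦ e ⟧ (toℚ (suc n))
pos₁ e h n = <-≤-trans (positive⁻¹ 1ℚ) (0≤q-p⇒p≤q {1ℚ} {⟦ e ⟧ (toℚ (suc n))} (nonNeg₁ (e :- con 1) h n))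

-- 2-log-convexity

-- fN/fD and gN/gD agree with the expansion of β(n+1)/β(n) up to O(n⁻⁴) and deviate from it on
-- either side in the next coefficient.
fN fD gN gD rP rQ rD : Expr → Expr
fN z = con 216 :* z :* z :+ con 1512 :* z :+ con 1712
fD z = con 27 :* z :* z :+ con 297 :* z :+ con 826
gN z = con 216 :* z :* z :+ con 1080 :* z :+ con 1136
gD z = con 27 :* z :* z :+ con 243 :* z :+ con 538
rP z = con 7 :* (z :+ con 3) :* (z :+ con 3) :+ con 7 :* (z :+ con 3) :- con 2
rQ z = con 8 :* (z :+ con 1) :* (z :+ con 2)
rD z = (z :+ con 5) :* (z :+ con 6)

-- From a bound N/M of b₁/b₀, the numerator and denominator of the resulting bound for
-- (b₀b₂ - b₁²)/b₁², where rD b₂ = rP b₁ + rQ b₀.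
excess scale : Expr → Expr → Expr → Expr
excess z N M = N :* rP z :* M :+ rQ z :* M :* M :- rD z :* N :* N
scale z N M = rD z :* N :* N

-- b₂/b₁ = (P + Q b₀/b₁)/D decreases in b₁/b₀, so the upper bound g/gd yields the lower bound (P + Q
-- gd/g)/D for the next ratio; `poly` says, with denominators cleared, that f₁/fd₁ lies below it.
-- The map shrinks deviations by a factor near 1/8, which leaves room for `poly` to hold.
step-lower : ∀ D P Q g gd f₁ fd₁ b₀ b₁ b₂ → 0ℚ < D → 0ℚ < g → 0ℚ ≤ fd₁ → 0ℚ ≤ Q → 0ℚ ≤ b₁ →
  D * b₂ ≡ P * b₁ + Q * b₀ → gd * b₁ ≤ g * b₀ → 0ℚ ≤ fd₁ * (g * P + Q * gd) - f₁ * D * g → f₁ * b₁ ≤ fd₁ * b₂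
step-lower D P Q g gd f₁ fd₁ b₀ b₁ b₂ 0<D 0<g 0≤fd₁ 0≤Q 0≤b₁ rec bound poly =
  *-cancelˡ {D * g} {f₁ * b₁} {fd₁ * b₂} (*-pos {D} {g} 0<D 0<g) (0≤q-p⇒p≤q {D * g * (f₁ * b₁)} {D * g * (fd₁ * b₂)} (subst (0ℚ ≤_) (begin
    (fd₁ * (g * P + Q * gd) - f₁ * D * g) * b₁ + fd₁ * Q * (g * b₀ - gd * b₁)   ≡⟨ eq₁ D P Q g gd f₁ fd₁ b₀ b₁ ⟩
    g * fd₁ * (P * b₁ + Q * b₀) - D * g * (f₁ * b₁)                             ≡⟨ cong (λ w → g * fd₁ * w - D * g * (f₁ * b₁)) rec ⟨
    g * fd₁ * (D * b₂) - D * g * (f₁ * b₁)                                      ≡⟨ eq₂ D g fd₁ b₂ (D * g * (f₁ * b₁)) ⟩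
    D * g * (fd₁ * b₂) - D * g * (f₁ * b₁)                                      ∎)
  (+-nonNeg {(fd₁ * (g * P + Q * gd) - f₁ * D * g) * b₁} {fd₁ * Q * (g * b₀ - gd * b₁)}
    (*-nonNeg {fd₁ * (g * P + Q * gd) - f₁ * D * g} {b₁} poly 0≤b₁)
    (*-nonNeg {fd₁ * Q} {g * b₀ - gd * b₁} (*-nonNeg {fd₁} {Q} 0≤fd₁ 0≤Q) (p≤q⇒0≤q-p {gd * b₁} {g * b₀} bound)))))
  where
  open ≡-Reasoning
  eq₁ : ∀ D P Q g gd f₁ fd₁ b₀ b₁ → (fd₁ * (g * P + Q * gd) - f₁ * D * g) * b₁ + fd₁ * Q * (g * b₀ - gd * b₁)
        ≡ g * fd₁ * (P * b₁ + Q * b₀) - D * g * (f₁ * b₁)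
  eq₁ = solve-∀ ℚ-ring
  eq₂ : ∀ D g fd b w → g * fd * (D * b) - w ≡ D * g * (fd * b) - w
  eq₂ = solve-∀ ℚ-ring

step-upper : ∀ D P Q f fd g₁ gd₁ b₀ b₁ b₂ → 0ℚ < D → 0ℚ < f → 0ℚ ≤ gd₁ → 0ℚ ≤ Q → 0ℚ ≤ b₁ →
  D * b₂ ≡ P * b₁ + Q * b₀ → f * b₀ ≤ fd * b₁ → 0ℚ ≤ g₁ * D * f - gd₁ * (f * P + Q * fd) → gd₁ * b₂ ≤ g₁ * b₁
step-upper D P Q f fd g₁ gd₁ b₀ b₁ b₂ 0<D 0<f 0≤gd₁ 0≤Q 0≤b₁ rec bound poly =
  *-cancelˡ {D * f} {gd₁ * b₂} {g₁ * b₁} (*-pos {D} {f} 0<D 0<f) (0≤q-p⇒p≤q {D * f * (gd₁ * b₂)} {D * f * (g₁ * b₁)} (subst (0ℚ ≤_) (begin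
    (g₁ * D * f - gd₁ * (f * P + Q * fd)) * b₁ + gd₁ * Q * (fd * b₁ - f * b₀)   ≡⟨ eq₁ D P Q f fd g₁ gd₁ b₀ b₁ ⟩
    D * f * (g₁ * b₁) - f * gd₁ * (P * b₁ + Q * b₀)                             ≡⟨ cong (λ w → D * f * (g₁ * b₁) - f * gd₁ * w) rec ⟨
    D * f * (g₁ * b₁) - f * gd₁ * (D * b₂)                                      ≡⟨ eq₂ D f gd₁ b₂ (D * f * (g₁ * b₁)) ⟩
    D * f * (g₁ * b₁) - D * f * (gd₁ * b₂)                                      ∎)
  (+-nonNeg {(g₁ * D * f - gd₁ * (f * P + Q * fd)) * b₁} {gd₁ * Q * (fd * b₁ - f * b₀)}
    (*-nonNeg {g₁ * D * f - gd₁ * (f * P + Q * fd)} {b₁} poly 0≤b₁)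
    (*-nonNeg {gd₁ * Q} {fd * b₁ - f * b₀} (*-nonNeg {gd₁} {Q} 0≤gd₁ 0≤Q) (p≤q⇒0≤q-p {f * b₀} {fd * b₁} bound)))))
  where
  open ≡-Reasoning
  eq₁ : ∀ D P Q f fd g₁ gd₁ b₀ b₁ → (g₁ * D * f - gd₁ * (f * P + Q * fd)) * b₁ + gd₁ * Q * (fd * b₁ - f * b₀)
        ≡ D * f * (g₁ * b₁) - f * gd₁ * (P * b₁ + Q * b₀)
  eq₁ = solve-∀ ℚ-ring
  eq₂ : ∀ D f gd b w → w - f * gd * (D * b) ≡ w - D * f * (gd * b)
  eq₂ = solve-∀ ℚ-ring

Lower Upper : ℚ → ℚ → ℚ → Set
Lower z b₀ b₁ = ⟦ fN X ⟧ z * b₀ ≤ ⟦ fD X ⟧ z * b₁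
Upper z b₀ b₁ = ⟦ gD X ⟧ z * b₁ ≤ ⟦ gN X ⟧ z * b₀

0≤β : ∀ n → 0ℚ ≤ β n
0≤β n = <⇒≤ (β-pos n)

0≤recQ : ∀ n → 0ℚ ≤ recQ (toℚ n)
0≤recQ n = <⇒≤ (recQ-pos n)

β-ratio-bounds : ∀ n → let z = toℚ (suc n) in Lower z (β (suc n)) (β (suc (suc n))) × Upper z (β (suc n)) (β (suc (suc n)))
-- The enclosure cannot start one index earlier: at z = 0 the lower bound would read 1712 · 1 ≤ 826
-- · 2. The terms of index 0 are therefore evaluated separately below.
β-ratio-bounds zero =
  toWitness {a? = ⟦ fN X ⟧ (toℚ 1) * β 1 ≤? ⟦ fD X ⟧ (toℚ 1) * β 2} _ ,
  toWitness {a? = ⟦ gD X ⟧ (toℚ 1) * β 2 ≤? ⟦ gN X ⟧ (toℚ 1) * β 1} _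
β-ratio-bounds (suc n) = let (lower , upper) = β-ratio-bounds n in
  subst (λ w → Lower w b₁ b₂) (sym (toℚ-suc (suc n)))
    (step-lower (recD z) (recP z) (recQ z) (⟦ gN X ⟧ z) (⟦ gD X ⟧ z) (⟦ fN X₁ ⟧ z) (⟦ fD X₁ ⟧ z) b₀ b₁ b₂
      (recD-pos (suc n)) (pos₁ (gN X) _ n) (nonNeg₁ (fD X₁) _ n) (0≤recQ (suc n)) (0≤β (suc (suc n)))
      (baxter-recurrence (suc n)) upper
      (nonNeg₁ (fD X₁ :* (gN X :* rP X :+ rQ X :* gD X) :- fN X₁ :* rD X :* gN X) _ n)) ,
  subst (λ w → Upper w b₁ b₂) (sym (toℚ-suc (suc n)))
    (step-upper (recD z) (recP z) (recQ z) (⟦ fN X ⟧ z) (⟦ fD X ⟧ z) (⟦ gN X₁ ⟧ z) (⟦ gD X₁ ⟧ z) b₀ b₁ b₂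
      (recD-pos (suc n)) (pos₁ (fN X) _ n) (nonNeg₁ (gD X₁) _ n) (0≤recQ (suc n)) (0≤β (suc (suc n)))
      (baxter-recurrence (suc n)) lower
      (nonNeg₁ (gN X₁ :* rD X :* fN X :- gD X₁ :* (fN X :* rP X :+ rQ X :* fD X)) _ n))
  where
  X₁ = X :+ con 1
  z = toℚ (suc n)
  b₀ = β (suc n)
  b₁ = β (suc (suc n))
  b₂ = β (suc (suc (suc n)))

-- With r = b₀/b₁ and r₀ = gd/g, the quantity (b₀b₂ - b₁²)/b₁² = (P r + Q r²)/D - 1 increases in r.
-- Its distance from the value at r₀ is (P + Q(r + r₀))(r - r₀)/D, the product at the head of the
-- calculation with denominators cleared.
𝓛-lower : ∀ D P Q g gd b₀ b₁ b₂ → 0ℚ ≤ P → 0ℚ ≤ Q → 0ℚ ≤ g → 0ℚ ≤ gd → 0ℚ ≤ b₀ → 0ℚ ≤ b₁ →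
  D * b₂ ≡ P * b₁ + Q * b₀ → gd * b₁ ≤ g * b₀ →
  (g * P * gd + Q * gd * gd - D * g * g) * (b₁ * b₁) ≤ D * g * g * (b₀ * b₂ - b₁ * b₁)
𝓛-lower D P Q g gd b₀ b₁ b₂ 0≤P 0≤Q 0≤g 0≤gd 0≤b₀ 0≤b₁ rec bound = 0≤q-p⇒p≤q
  {(g * P * gd + Q * gd * gd - D * g * g) * (b₁ * b₁)} {D * g * g * (b₀ * b₂ - b₁ * b₁)} (subst (0ℚ ≤_) (begin
    (g * P * b₁ + Q * (gd * b₁ + g * b₀)) * (g * b₀ - gd * b₁)
      ≡⟨ eq₁ D P Q g gd b₀ b₁ ⟩
    g * g * b₀ * (P * b₁ + Q * b₀) - D * g * g * (b₁ * b₁) - (g * P * gd + Q * gd * gd - D * g * g) * (b₁ * b₁)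
      ≡⟨ cong (λ w → g * g * b₀ * w - D * g * g * (b₁ * b₁) - (g * P * gd + Q * gd * gd - D * g * g) * (b₁ * b₁)) rec ⟨
    g * g * b₀ * (D * b₂) - D * g * g * (b₁ * b₁) - (g * P * gd + Q * gd * gd - D * g * g) * (b₁ * b₁)
      ≡⟨ eq₂ D g b₀ b₁ b₂ ((g * P * gd + Q * gd * gd - D * g * g) * (b₁ * b₁)) ⟩
    D * g * g * (b₀ * b₂ - b₁ * b₁) - (g * P * gd + Q * gd * gd - D * g * g) * (b₁ * b₁) ∎)
  (*-nonNeg {g * P * b₁ + Q * (gd * b₁ + g * b₀)} {g * b₀ - gd * b₁}
    (+-nonNeg {g * P * b₁} {Q * (gd * b₁ + g * b₀)} (*-nonNeg {g * P} {b₁} (*-nonNeg {g} {P} 0≤g 0≤P) 0≤b₁)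
      (*-nonNeg {Q} {gd * b₁ + g * b₀} 0≤Q (+-nonNeg {gd * b₁} {g * b₀} (*-nonNeg {gd} {b₁} 0≤gd 0≤b₁) (*-nonNeg {g} {b₀} 0≤g 0≤b₀))))
    (p≤q⇒0≤q-p {gd * b₁} {g * b₀} bound)))
  where
  open ≡-Reasoning
  eq₁ : ∀ D P Q g gd b₀ b₁ → (g * P * b₁ + Q * (gd * b₁ + g * b₀)) * (g * b₀ - gd * b₁)
    ≡ g * g * b₀ * (P * b₁ + Q * b₀) - D * g * g * (b₁ * b₁) - (g * P * gd + Q * gd * gd - D * g * g) * (b₁ * b₁)
  eq₁ = solve-∀ ℚ-ring
  eq₂ : ∀ D g b₀ b₁ b₂ w → g * g * b₀ * (D * b₂) - D * g * g * (b₁ * b₁) - w ≡ D * g * g * (b₀ * b₂ - b₁ * b₁) - w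
  eq₂ = solve-∀ ℚ-ring

𝓛-upper : ∀ D P Q f fd b₀ b₁ b₂ → 0ℚ ≤ P → 0ℚ ≤ Q → 0ℚ ≤ f → 0ℚ ≤ fd → 0ℚ ≤ b₀ → 0ℚ ≤ b₁ →
  D * b₂ ≡ P * b₁ + Q * b₀ → f * b₀ ≤ fd * b₁ →
  D * f * f * (b₀ * b₂ - b₁ * b₁) ≤ (f * P * fd + Q * fd * fd - D * f * f) * (b₁ * b₁)
𝓛-upper D P Q f fd b₀ b₁ b₂ 0≤P 0≤Q 0≤f 0≤fd 0≤b₀ 0≤b₁ rec bound = 0≤q-p⇒p≤q
  {D * f * f * (b₀ * b₂ - b₁ * b₁)} {(f * P * fd + Q * fd * fd - D * f * f) * (b₁ * b₁)} (subst (0ℚ ≤_) (begin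
    (f * P * b₁ + Q * (fd * b₁ + f * b₀)) * (fd * b₁ - f * b₀)
      ≡⟨ eq₁ D P Q f fd b₀ b₁ ⟩
    (f * P * fd + Q * fd * fd - D * f * f) * (b₁ * b₁) - (f * f * b₀ * (P * b₁ + Q * b₀) - D * f * f * (b₁ * b₁))
      ≡⟨ cong (λ w → (f * P * fd + Q * fd * fd - D * f * f) * (b₁ * b₁) - (f * f * b₀ * w - D * f * f * (b₁ * b₁))) rec ⟨
    (f * P * fd + Q * fd * fd - D * f * f) * (b₁ * b₁) - (f * f * b₀ * (D * b₂) - D * f * f * (b₁ * b₁))
      ≡⟨ eq₂ D f b₀ b₁ b₂ ((f * P * fd + Q * fd * fd - D * f * f) * (b₁ * b₁)) ⟩
    (f * P * fd + Q * fd * fd - D * f * f) * (b₁ * b₁) - D * f * f * (b₀ * b₂ - b₁ * b₁) ∎)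
  (*-nonNeg {f * P * b₁ + Q * (fd * b₁ + f * b₀)} {fd * b₁ - f * b₀}
    (+-nonNeg {f * P * b₁} {Q * (fd * b₁ + f * b₀)} (*-nonNeg {f * P} {b₁} (*-nonNeg {f} {P} 0≤f 0≤P) 0≤b₁)
      (*-nonNeg {Q} {fd * b₁ + f * b₀} 0≤Q (+-nonNeg {fd * b₁} {f * b₀} (*-nonNeg {fd} {b₁} 0≤fd 0≤b₁) (*-nonNeg {f} {b₀} 0≤f 0≤b₀))))
    (p≤q⇒0≤q-p {f * b₀} {fd * b₁} bound)))
  where
  open ≡-Reasoning
  eq₁ : ∀ D P Q f fd b₀ b₁ → (f * P * b₁ + Q * (fd * b₁ + f * b₀)) * (fd * b₁ - f * b₀)
    ≡ (f * P * fd + Q * fd * fd - D * f * f) * (b₁ * b₁) - (f * f * b₀ * (P * b₁ + Q * b₀) - D * f * f * (b₁ * b₁))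
  eq₁ = solve-∀ ℚ-ring
  eq₂ : ∀ D f b₀ b₁ b₂ w → w - (f * f * b₀ * (D * b₂) - D * f * f * (b₁ * b₁)) ≡ w - D * f * f * (b₀ * b₂ - b₁ * b₁)
  eq₂ = solve-∀ ℚ-ring

lowN lowD upN upD : Expr → Expr
lowN z = excess z (gN z) (gD z)
lowD z = scale z (gN z) (gD z)
upN z = excess z (fN z) (fD z)
upD z = scale z (fN z) (fD z)

𝓛-β-lower : ∀ n → let z = toℚ (suc n) in
  ⟦ lowN X ⟧ z * (β (suc (suc n)) * β (suc (suc n))) ≤ ⟦ lowD X ⟧ z * 𝓛 β (suc n)
𝓛-β-lower n = 𝓛-lower (recD z) (recP z) (recQ z) (⟦ gN X ⟧ z) (⟦ gD X ⟧ z) (β (suc n)) (β (suc (suc n))) (β (suc (suc (suc n))))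
  (<⇒≤ (recP-pos (suc n))) (0≤recQ (suc n)) (nonNeg₁ (gN X) _ n) (nonNeg₁ (gD X) _ n) (0≤β (suc n)) (0≤β (suc (suc n)))
  (baxter-recurrence (suc n)) (proj₂ (β-ratio-bounds n))
  where z = toℚ (suc n)

𝓛-β-upper : ∀ n → let z = toℚ (suc n) in
  ⟦ upD X ⟧ z * 𝓛 β (suc n) ≤ ⟦ upN X ⟧ z * (β (suc (suc n)) * β (suc (suc n)))
𝓛-β-upper n = 𝓛-upper (recD z) (recP z) (recQ z) (⟦ fN X ⟧ z) (⟦ fD X ⟧ z) (β (suc n)) (β (suc (suc n))) (β (suc (suc (suc n))))
  (<⇒≤ (recP-pos (suc n))) (0≤recQ (suc n)) (nonNeg₁ (fN X) _ n) (nonNeg₁ (fD X) _ n) (0≤β (suc n)) (0≤β (suc (suc n)))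
  (baxter-recurrence (suc n)) (proj₁ (β-ratio-bounds n))
  where z = toℚ (suc n)

0≤𝓛-β : ∀ n → 0ℚ ≤ 𝓛 β n
0≤𝓛-β zero    = toWitness {a? = 0ℚ ≤? 𝓛 β 0} _
0≤𝓛-β (suc n) = *-cancelˡ {⟦ lowD X ⟧ z} {0ℚ} {𝓛 β (suc n)} (pos₁ (lowD X) _ n)
  (≤-trans (≤-reflexive (*-zeroʳ (⟦ lowD X ⟧ z)))
    (≤-trans (*-nonNeg {⟦ lowN X ⟧ z} {b * b} (nonNeg₁ (lowN X) _ n) (*-nonNeg {b} {b} (0≤β (suc (suc n))) (0≤β (suc (suc n)))))
             (𝓛-β-lower n)))
  where
  z = toℚ (suc n)
  b = β (suc (suc n))

-- Since b₁b₃ = b₂² + u₁, the bounds turn u₀u₂ ≥ u₁² into an inequality between their coefficients.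
𝓛²-bound : ∀ L₀ M₀ L₂ M₂ H K b₁ b₂ b₃ u₀ u₁ u₂ → 0ℚ ≤ L₀ → 0ℚ < M₀ → 0ℚ ≤ L₂ → 0ℚ < M₂ → 0ℚ < H → 0ℚ ≤ K →
  0ℚ ≤ u₀ → 0ℚ ≤ u₁ → b₁ * b₃ ≡ b₂ * b₂ + u₁ →
  L₀ * (b₁ * b₁) ≤ M₀ * u₀ → L₂ * (b₃ * b₃) ≤ M₂ * u₂ → K * u₁ ≤ H * (b₂ * b₂) →
  0ℚ ≤ L₀ * L₂ * ((H + K) * (H + K)) - H * H * (M₀ * M₂) → 0ℚ ≤ u₀ * u₂ - u₁ * u₁
𝓛²-bound L₀ M₀ L₂ M₂ H K b₁ b₂ b₃ u₀ u₁ u₂ 0≤L₀ 0<M₀ 0≤L₂ 0<M₂ 0<H 0≤K 0≤u₀ 0≤u₁ b₁b₃ low₀ low₂ up poly =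
  p≤q⇒0≤q-p {u₁ * u₁} {u₀ * u₂} (*-cancelˡ {H * H * (M₀ * M₂)} {u₁ * u₁} {u₀ * u₂}
    (*-pos {H * H} {M₀ * M₂} (*-pos {H} {H} 0<H 0<H) (*-pos {M₀} {M₂} 0<M₀ 0<M₂)) (begin
    H * H * (M₀ * M₂) * (u₁ * u₁)
      ≤⟨ *-monoʳ {u₁ * u₁} {H * H * (M₀ * M₂)} {L₀ * L₂ * ((H + K) * (H + K))} (*-nonNeg {u₁} {u₁} 0≤u₁ 0≤u₁)
           (0≤q-p⇒p≤q {H * H * (M₀ * M₂)} {L₀ * L₂ * ((H + K) * (H + K))} poly) ⟩
    L₀ * L₂ * ((H + K) * (H + K)) * (u₁ * u₁)
      -- Adding H u₁ to K u₁ ≤ H b₂² gives (H + K) u₁ ≤ H (b₂² + u₁) = H b₁ b₃. This bounds u₁ by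
      -- the outer terms, to which the bounds on u₀ and u₂ refer.
      ≡⟨ eq₁ (L₀ * L₂) H K u₁ ⟩
    L₀ * L₂ * ((K * u₁ + H * u₁) * (K * u₁ + H * u₁))
      ≤⟨ *-monoˡ {L₀ * L₂} {(K * u₁ + H * u₁) * (K * u₁ + H * u₁)} {(H * (b₂ * b₂) + H * u₁) * (H * (b₂ * b₂) + H * u₁)}
           (*-nonNeg {L₀} {L₂} 0≤L₀ 0≤L₂)
           (*-mono {K * u₁ + H * u₁} {H * (b₂ * b₂) + H * u₁} {K * u₁ + H * u₁} {H * (b₂ * b₂) + H * u₁}
             (≤-trans 0≤s s≤) 0≤s s≤ s≤) ⟩
    L₀ * L₂ * ((H * (b₂ * b₂) + H * u₁) * (H * (b₂ * b₂) + H * u₁))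
      ≡⟨ eq₂ (L₀ * L₂) H (b₂ * b₂) u₁ ⟩
    H * H * (L₀ * L₂ * ((b₂ * b₂ + u₁) * (b₂ * b₂ + u₁)))
      ≡⟨ cong (λ w → H * H * (L₀ * L₂ * (w * w))) b₁b₃ ⟨
    H * H * (L₀ * L₂ * ((b₁ * b₃) * (b₁ * b₃)))
      ≡⟨ eq₃ (H * H) L₀ L₂ b₁ b₃ ⟩
    H * H * (L₀ * (b₁ * b₁) * (L₂ * (b₃ * b₃)))
      ≤⟨ *-monoˡ {H * H} {L₀ * (b₁ * b₁) * (L₂ * (b₃ * b₃))} {M₀ * u₀ * (M₂ * u₂)} (<⇒≤ (*-pos {H} {H} 0<H 0<H))
           (*-mono {L₀ * (b₁ * b₁)} {M₀ * u₀} {L₂ * (b₃ * b₃)} {M₂ * u₂}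
             (*-nonNeg {M₀} {u₀} (<⇒≤ 0<M₀) 0≤u₀) (*-nonNeg {L₂} {b₃ * b₃} 0≤L₂ (0≤p² b₃)) low₀ low₂) ⟩
    H * H * (M₀ * u₀ * (M₂ * u₂))
      ≡⟨ eq₄ (H * H) M₀ M₂ u₀ u₂ ⟩
    H * H * (M₀ * M₂) * (u₀ * u₂) ∎))
  where
  open ≤-Reasoning
  0≤p² : ∀ p → 0ℚ ≤ p * p
  0≤p² p = subst (0ℚ ≤_) (∣p∣*∣p∣≡p² p) (*-nonNeg {∣ p ∣} {∣ p ∣} (0≤∣p∣ p) (0≤∣p∣ p))
    where
    ∣p∣*∣p∣≡p² : ∀ p → ∣ p ∣ * ∣ p ∣ ≡ p * p
    ∣p∣*∣p∣≡p² p with ∣p∣≡p∨∣p∣≡-p p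
    ... | inj₁ eq = cong₂ _*_ eq eq
    ... | inj₂ eq = trans (cong₂ _*_ eq eq) (neg² p)
      where
      neg² : ∀ p → - p * - p ≡ p * p
      neg² = solve-∀ ℚ-ring
  0≤s : 0ℚ ≤ K * u₁ + H * u₁
  0≤s = +-nonNeg {K * u₁} {H * u₁} (*-nonNeg {K} {u₁} 0≤K 0≤u₁) (*-nonNeg {H} {u₁} (<⇒≤ 0<H) 0≤u₁)
  s≤ : K * u₁ + H * u₁ ≤ H * (b₂ * b₂) + H * u₁
  s≤ = +-monoˡ-≤ (H * u₁) {K * u₁} {H * (b₂ * b₂)} up
  eq₁ : ∀ l H K u → l * ((H + K) * (H + K)) * (u * u) ≡ l * ((K * u + H * u) * (K * u + H * u))
  eq₁ = solve-∀ ℚ-ring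
  eq₂ : ∀ l H b u → l * ((H * b + H * u) * (H * b + H * u)) ≡ H * H * (l * ((b + u) * (b + u)))
  eq₂ = solve-∀ ℚ-ring
  eq₃ : ∀ h l₀ l₂ b c → h * (l₀ * l₂ * ((b * c) * (b * c))) ≡ h * (l₀ * (b * b) * (l₂ * (c * c)))
  eq₃ = solve-∀ ℚ-ring
  eq₄ : ∀ h m₀ m₂ u v → h * (m₀ * u * (m₂ * v)) ≡ h * (m₀ * m₂) * (u * v)
  eq₄ = solve-∀ ℚ-ring

0≤𝓛²-β : ∀ n → 0ℚ ≤ 𝓛^ 2 β n
0≤𝓛²-β zero    = toWitness {a? = 0ℚ ≤? 𝓛^ 2 β 0} _
0≤𝓛²-β (suc n) = 𝓛²-bound (⟦ lowN X ⟧ z) (⟦ lowD X ⟧ z) (⟦ lowN X₂ ⟧ z) (⟦ lowD X₂ ⟧ z) (⟦ upN X₁ ⟧ z) (⟦ upD X₁ ⟧ z)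
  b₁ b₂ b₃ (𝓛 β (suc n)) (𝓛 β (suc (suc n))) (𝓛 β (suc (suc (suc n))))
  (nonNeg₁ (lowN X) _ n) (pos₁ (lowD X) _ n) (nonNeg₁ (lowN X₂) _ n) (pos₁ (lowD X₂) _ n) (pos₁ (upN X₁) _ n) (nonNeg₁ (upD X₁) _ n)
  (0≤𝓛-β (suc n)) (0≤𝓛-β (suc (suc n))) (eq b₁ b₂ b₃)
  (𝓛-β-lower n)
  (subst (λ w → ⟦ lowN X ⟧ w * (b₃ * b₃) ≤ ⟦ lowD X ⟧ w * 𝓛 β (suc (suc (suc n)))) z₂ (𝓛-β-lower (suc (suc n))))
  (subst (λ w → ⟦ upD X ⟧ w * 𝓛 β (suc (suc n)) ≤ ⟦ upN X ⟧ w * (b₂ * b₂)) z₁ (𝓛-β-upper (suc n)))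
  (nonNeg₁ (lowN X :* lowN X₂ :* ((upN X₁ :+ upD X₁) :* (upN X₁ :+ upD X₁)) :- upN X₁ :* upN X₁ :* (lowD X :* lowD X₂)) _ n)
  where
  X₁ X₂ : Expr
  X₁ = X :+ con 1
  X₂ = X :+ con 1 :+ con 1
  z = toℚ (suc n)
  b₁ = β (suc (suc n))
  b₂ = β (suc (suc (suc n)))
  b₃ = β (suc (suc (suc (suc n))))
  z₁ : toℚ (suc (suc n)) ≡ z + 1ℚ
  z₁ = toℚ-suc (suc n)
  z₂ : toℚ (suc (suc (suc n))) ≡ z + 1ℚ + 1ℚ
  z₂ = trans (toℚ-suc (suc (suc n))) (cong (_+ 1ℚ) z₁)
  eq : ∀ a b c → a * c ≡ b * b + (a * c - b * b)
  eq = solve-∀ ℚ-ring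

theorem1p3 : ((r : ℕ) → 1 ℕ.≤ r → AsympLogConvex r baxterSeq) × LogConvex 2 baxterSeq
theorem1p3 = (λ r _ → witness⇒asympLogConvex r β-witness) , logConvex
  where
  logConvex : LogConvex 2 baxterSeq
  logConvex 1 _ _ = 0≤𝓛-β
  logConvex 2 _ _ = 0≤𝓛²-β
  logConvex (suc (suc (suc _))) _ (ℕ.s≤s (ℕ.s≤s ()))
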